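{- For every prime power $q$ and every integer $n\geq1$, \[ \frac{1}{q^n}\sum_{f\in\mathcal{M}_n}d_2(f)\,d_2(f+1)=(n+1)^2-\frac{1}{q}(n-1)^2. \]
   Context: $\mathcal{M}_n$ is the set of monic polynomials of degree $n$ in $\mathbb{F}_q[t]$. For a monic polynomial $f$, $d_2(f)$ is the number of ordered pairs $(a_1,a_2)$ of monic polynomials in $\mathbb{F}_q[t]$ with $f=a_1a_2$. -}

module Defs where

open import Level using (0ℓ)
open import Data.Nat as ℕ using (ℕ; zero; suc; _∸_)
open import Data.List using (List; []; _∷_; _++_; map; length; concatMap; filter; cartesianProduct; upTo; [_])
open import Data.List.Membership.Propositional using (_∈_)
open import Data.List.Relation.Unary.Unique.Propositional using (Unique)
open import Data.List.Relation.Binary.Pointwise as PW using (Pointwise)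
open import Data.Nat.ListAction using (sum)
open import Data.Vec as Vec using (Vec; toList)
open import Data.Product using (_×_; _,_; ∃)
open import Relation.Nullary using (¬_; Dec)
open import Relation.Binary.PropositionalEquality using (_≡_)
open import Relation.Binary.Definitions using (DecidableEquality)
open import Algebra.Structures using (IsCommutativeRing)

record FiniteField : Set₁ where
  infixl 7 _*_
  infixl 6 _+_
  field
    Carrier : Set
    _+_ _*_ : Carrier → Carrier → Carrier
    -_      : Carrier → Carrier
    0# 1#   : Carrier
    isCommutativeRing : IsCommutativeRing _≡_ _+_ _*_ -_ 0# 1#
    1≢0     : ¬ (1# ≡ 0#)
    inverse : ∀ x → ¬ (x ≡ 0#) → ∃ λ y → x * y ≡ 1#
    _≟_     : DecidableEquality Carrier
    elements : List Carrier
    elements-unique   : Unique elements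
    elements-complete : ∀ x → x ∈ elements

  card : ℕ
  card = length elements

module Poly (F : FiniteField) where
  open FiniteField F

  -- Polynomials as coefficient lists, lowest degree first.
  Pol : Set
  Pol = List Carrier

  addP : Pol → Pol → Pol
  addP []       q        = q
  addP p        []       = p
  addP (a ∷ p)  (b ∷ q)  = (a + b) ∷ addP p q

  mulP : Pol → Pol → Pol
  mulP []      q = []
  mulP (a ∷ p) q = addP (map (a *_) q) (0# ∷ mulP p q)

  monic : ∀ {k} → Vec Carrier k → Pol
  monic v = toList v ++ [ 1# ]

  allVecs : (k : ℕ) → List (Vec Carrier k)
  allVecs zero    = Vec.[] ∷ []
  allVecs (suc k) = concatMap (λ a → map (a Vec.∷_) (allVecs k)) elements

  𝓜 : ℕ → List Pol
  𝓜 k = map monic (allVecs k)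

  _≟P_ : (p q : Pol) → Dec (Pointwise _≡_ p q)
  _≟P_ = PW.decidable _≟_

  -- Degree of a nonzero polynomial stored without trailing zeros
  -- (monic polynomials are always stored this way).
  deg : Pol → ℕ
  deg p = length p ∸ 1

  -- d₂(f): the number of ordered pairs (a₁ , a₂) of monic polynomials
  -- with f = a₁ a₂.  For monic f of degree n, a₁ has some degree k ≤ n
  -- and a₂ has degree n ∸ k.
  pairsWithProduct : Pol → ℕ → List (Pol × Pol)
  pairsWithProduct f k =
    filter (λ { (a₁ , a₂) → mulP a₁ a₂ ≟P f }) (cartesianProduct (𝓜 k) (𝓜 (deg f ∸ k)))

  d₂ : Pol → ℕ
  d₂ f = sum (map (λ k → length (pairsWithProduct f k)) (upTo (suc (deg f))))

  plusOne : Pol → Pol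
  plusOne f = addP f [ 1# ]

  S : ℕ → ℕ
  S n = sum (map (λ f → d₂ f ℕ.* d₂ (plusOne f)) (𝓜 n))

{-# OPTIONS --safe #-}

-- Expanding both divisor functions, S n counts the solutions of b b′ = a a′ + 1 in monic
-- polynomials with deg a + deg a′ = deg b + deg b′ = n, sorted by (deg a , deg b) ∈ {0,…,n}².
-- Exchanging the two factors on a side, and the two sides at the price of a sign, we may take
-- k = deg a to be the least of the four degrees.  Then a′ is determined by a ∣ b b′ − 1, and
-- division of b and b′ by a leaves q^(n−2k) free choices of quotients times the number of
-- (a , r , v) with r, v reduced modulo a and r v ≡ 1 (mod a).
-- For k = 0 there is one such triple.  For k ≥ 1 they are counted by the Euclidean algorithm:
-- scale r to be monic, say of degree i < k; the v with a ∣ r v + e correspond to the w reduced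
-- modulo r with r ∣ a w − e, and reducing a modulo r gives the same problem with k replaced by i.
-- There are (q−1) q^(2k−1) triples, so a pair of degrees contributes q^n, except that the (n−1)²
-- pairs with 0 < deg a, deg b < n contribute q^n − q^(n−1).

module Submission where

open import Defs
open import Algebra.Bundles using (CommutativeRing)
import Algebra.Properties.AbelianGroup as AbelianGroupProperties
import Algebra.Solver.Ring.NaturalCoefficients.Default as SemiringSolver
open import Algebra.Structures using (IsCommutativeRing)
open import Data.Bool using (true; false)
open import Data.Bool.Properties using (T-irrelevant)
open import Data.Empty using (⊥; ⊥-elim)
open import Data.Fin using (Fin; zero; suc; toℕ)
open import Data.Fin.Permutation using (↔⇒≡)
open import Data.Fin.Properties using (0↔⊥; 1↔⊤; +↔⊎; *↔×; toℕ<n)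
import Data.Integer as ℤ
import Data.Integer.Properties as ℤₚ
open import Data.List using (List; []; _∷_; _++_; [_]; map; length; lookup; concatMap; filter; cartesianProduct; upTo; applyUpTo)
open import Data.List.Membership.Propositional using (_∈_)
open import Data.List.Membership.Propositional.Properties using (∈-lookup)
open import Data.List.Properties using (map-++; map-cong; map-∘; map-upTo; length-map; length-upTo)
open import Data.List.Relation.Binary.Pointwise using (Pointwise; []; _∷_)
open import Data.List.Relation.Unary.All as All using ()
open import Data.List.Relation.Unary.AllPairs using (_∷_)
open import Data.List.Relation.Unary.Any using (index)
open import Data.List.Relation.Unary.Any.Properties using (lookup-index)
open import Data.List.Relation.Unary.Unique.Propositional using (Unique)
open import Data.Nat using (ℕ; _≥_)
open import Data.Nat as ℕ using (zero; suc; _≤_; _<_; z≤n; s≤s; _∸_; _⊔_)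
open import Data.Nat.ListAction using (sum)
open import Data.Nat.ListAction.Properties using (sum-++)
import Data.Nat.Properties as ℕₚ
open import Data.Nat.Solver using (module +-*-Solver)
open import Data.Product using (Σ; _×_; _,_; proj₁; proj₂)
open import Data.Product.Function.Dependent.Propositional using (Σ-↔)
open import Data.Product.Function.NonDependent.Propositional using (_×-↔_)
open import Data.Sum using (_⊎_; inj₁; inj₂)
open import Data.Sum.Function.Propositional using (_⊎-↔_)
open import Data.Unit using (⊤; tt)
open import Data.Vec as Vec using (Vec; toList; []; _∷_)
open import Function using (_∘_)
open import Function.Bundles using (_↔_; mk↔ₛ′)
open import Function.Properties.Inverse using (↔-refl; ↔-sym; ↔-trans)
open import Function.Related.TypeIsomorphisms using (Σ-distribʳ-⊎; Σ-distribˡ-⊎; Σ-assoc)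
open import Level using (0ℓ)
open import Relation.Binary.PropositionalEquality using (_≡_; refl; sym; trans; cong; cong₂; subst; module ≡-Reasoning)
open import Relation.Binary.PropositionalEquality.WithK using (≡-irrelevant)
import Relation.Binary.Reasoning.Setoid as SetoidReasoning
open import Relation.Nullary using (¬_; yes; no; Dec; Irrelevant; _because_)
open import Relation.Nullary.Decidable using (True; toWitness; fromWitness; ¬?)

private module ℕS = +-*-Solver

-- Counting by bijections with `Fin n`.

module _ {A : Set} where

  Σ-cong : {B C : A → Set} → (∀ a → B a ↔ C a) → Σ A B ↔ Σ A C
  Σ-cong e = Σ-↔ ↔-refl (λ {a} → e a)

  Σ-swap : {B : Set} {P : A → B → Set} → (Σ A λ a → Σ B λ b → P a b) ↔ (Σ B λ b → Σ A λ a → P a b)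
  Σ-swap = mk↔ₛ′ (λ (a , b , p) → b , a , p) (λ (b , a , p) → a , b , p) (λ _ → refl) (λ _ → refl)

  Σ-pull : {D : Set} {P : A → Set} → (Σ A λ a → D × P a) ↔ (D × Σ A P)
  Σ-pull = mk↔ₛ′ (λ (a , d , p) → d , a , p) (λ (d , a , p) → a , d , p) (λ _ → refl) (λ _ → refl)

  Σ-≡ : {P : A → Set} → (∀ a → Irrelevant (P a)) → {u v : Σ A P} → proj₁ u ≡ proj₁ v → u ≡ v
  Σ-≡ irr {a , p} {.a , q} refl = cong (a ,_) (irr a p q)

  Σ-singleton : {P : A → Set} (a : A) → (Σ A λ x → x ≡ a × P x) ↔ P a
  Σ-singleton a = mk↔ₛ′ (λ { (_ , refl , p) → p }) (λ p → a , refl , p) (λ _ → refl) (λ { (_ , refl , p) → refl })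

-- Irrelevance of P and Q reduces equality of pairs to equality of first components, so `f` and `g`
-- have to be mutually inverse only on the two subsets.
subset↔ : {A B : Set} {P : A → Set} {Q : B → Set} →
          (∀ a → Irrelevant (P a)) → (∀ b → Irrelevant (Q b)) →
          (f : A → B) (g : B → A) → (∀ a → P a → Q (f a)) → (∀ b → Q b → P (g b)) →
          (∀ b → Q b → f (g b) ≡ b) → (∀ a → P a → g (f a) ≡ a) → Σ A P ↔ Σ B Q
subset↔ irrP irrQ f g f-resp g-resp fg gf = mk↔ₛ′
  (λ (a , p) → f a , f-resp a p) (λ (b , q) → g b , g-resp b q)
  (λ (b , q) → Σ-≡ irrQ (fg b q)) (λ (a , p) → Σ-≡ irrP (gf a p))

proposition↔ : {P Q : Set} → Irrelevant P → Irrelevant Q → (P → Q) → (Q → P) → P ↔ Q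
proposition↔ irrP irrQ f g = mk↔ₛ′ f g (λ q → irrQ _ q) (λ p → irrP _ p)

card-⊥ : {A : Set} → ¬ A → A ↔ Fin 0
card-⊥ ¬a = mk↔ₛ′ (λ a → ⊥-elim (¬a a)) (λ ()) (λ ()) (λ a → ⊥-elim (¬a a))

card-singleton : {A : Set} (a : A) → Irrelevant A → A ↔ Fin 1
card-singleton a irr = ↔-trans (mk↔ₛ′ _ (λ _ → a) (λ _ → refl) (λ x → irr a x)) (↔-sym 1↔⊤)

card-× : {A B : Set} {m n : ℕ} → A ↔ Fin m → B ↔ Fin n → (A × B) ↔ Fin (m ℕ.* n)
card-× f g = ↔-trans (f ×-↔ g) (↔-sym *↔×)

card-⊎ : {A B : Set} {m n : ℕ} → A ↔ Fin m → B ↔ Fin n → (A ⊎ B) ↔ Fin (m ℕ.+ n)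
card-⊎ f g = ↔-trans (f ⊎-↔ g) (↔-sym +↔⊎)

card-unique : {A : Set} {m n : ℕ} → A ↔ Fin m → A ↔ Fin n → m ≡ n
card-unique f g = ↔⇒≡ (↔-trans (↔-sym f) g)

Σ-Fin-suc : ∀ {n} {P : Fin (suc n) → Set} → Σ (Fin (suc n)) P ↔ (P zero ⊎ Σ (Fin n) (P ∘ suc))
Σ-Fin-suc = mk↔ₛ′
  (λ { (zero , p) → inj₁ p ; (suc i , p) → inj₂ (i , p) })
  (λ { (inj₁ p) → zero , p ; (inj₂ (i , p)) → suc i , p })
  (λ { (inj₁ p) → refl ; (inj₂ (i , p)) → refl })
  (λ { (zero , p) → refl ; (suc i , p) → refl })

card-Σ-Fin : ∀ n (g : ℕ → ℕ) → Σ (Fin n) (Fin ∘ g ∘ toℕ) ↔ Fin (sum (map g (upTo n)))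
card-Σ-Fin n g = subst (λ xs → Σ (Fin n) (Fin ∘ g ∘ toℕ) ↔ Fin (sum xs)) (sym (map-upTo g n)) (go n g)
  where
  go : ∀ n (g : ℕ → ℕ) → Σ (Fin n) (Fin ∘ g ∘ toℕ) ↔ Fin (sum (applyUpTo g n))
  go zero    g = card-⊥ λ ()
  go (suc n) g = ↔-trans Σ-Fin-suc (card-⊎ ↔-refl (go n (g ∘ suc)))

-- Plays the role of "each element occurs exactly once", in the form that counting uses: sums over
-- `xs` are cardinalities of dependent sums. In this form it passes through `concatMap` by
-- induction, without membership proofs.
Enumerates : {A : Set} → List A → Set
Enumerates {A} xs = ∀ (g : A → ℕ) → Σ A (Fin ∘ g) ↔ Fin (sum (map g xs))

card-Σ : {A : Set} {xs : List A} → Enumerates xs → {P : A → Set} (g : A → ℕ) →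
         (∀ a → P a ↔ Fin (g a)) → Σ A P ↔ Fin (sum (map g xs))
card-Σ e g h = ↔-trans (Σ-cong h) (e g)

card-Σ-lookup : {A : Set} (xs : List A) (g : A → ℕ) →
                Σ (Fin (length xs)) (Fin ∘ g ∘ lookup xs) ↔ Fin (sum (map g xs))
card-Σ-lookup []       g = card-⊥ λ ()
card-Σ-lookup (x ∷ xs) g = ↔-trans Σ-Fin-suc (card-⊎ ↔-refl (card-Σ-lookup xs g))

lookup-injective : {A : Set} {xs : List A} → Unique xs → ∀ i j → lookup xs i ≡ lookup xs j → i ≡ j
lookup-injective (p ∷ u) zero    zero    e = refl
lookup-injective (p ∷ u) zero    (suc j) e = ⊥-elim (All.lookup p (∈-lookup j) e)
lookup-injective (p ∷ u) (suc i) zero    e = ⊥-elim (All.lookup p (∈-lookup i) (sym e))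
lookup-injective (p ∷ u) (suc i) (suc j) e = cong suc (lookup-injective u i j e)

module _ {A : Set} {xs : List A} (unique : Unique xs) (complete : ∀ x → x ∈ xs) where

  card-list : A ↔ Fin (length xs)
  card-list = mk↔ₛ′ (λ x → index (complete x)) (lookup xs)
    (λ i → lookup-injective unique _ i (sym (lookup-index (complete (lookup xs i)))))
    (λ x → sym (lookup-index (complete x)))

  enumerates : Enumerates xs
  enumerates g = ↔-trans (↔-sym (Σ-↔ (↔-sym card-list) ↔-refl)) (card-Σ-lookup xs g)

sum-map-concatMap : {A B : Set} (g : B → ℕ) (h : A → List B) (xs : List A) →
                    sum (map g (concatMap h xs)) ≡ sum (map (λ x → sum (map g (h x))) xs)
sum-map-concatMap g h []       = refl
sum-map-concatMap g h (x ∷ xs) = begin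
  sum (map g (h x ++ concatMap h xs))                ≡⟨ cong sum (map-++ g (h x) (concatMap h xs)) ⟩
  sum (map g (h x) ++ map g (concatMap h xs))        ≡⟨ sum-++ (map g (h x)) _ ⟩
  sum (map g (h x)) ℕ.+ sum (map g (concatMap h xs)) ≡⟨ cong (sum (map g (h x)) ℕ.+_) (sum-map-concatMap g h xs) ⟩
  sum (map g (h x)) ℕ.+ sum (map (λ x → sum (map g (h x))) xs) ∎
  where open ≡-Reasoning

sum-map-cartesianProduct : {A B : Set} (g : A × B → ℕ) (xs : List A) (ys : List B) →
                           sum (map g (cartesianProduct xs ys)) ≡ sum (map (λ x → sum (map (λ y → g (x , y)) ys)) xs)
sum-map-cartesianProduct g []       ys = refl
sum-map-cartesianProduct g (x ∷ xs) ys = begin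
  sum (map g (map (x ,_) ys ++ cartesianProduct xs ys))
    ≡⟨ cong sum (map-++ g (map (x ,_) ys) (cartesianProduct xs ys)) ⟩
  sum (map g (map (x ,_) ys) ++ map g (cartesianProduct xs ys))
    ≡⟨ sum-++ (map g (map (x ,_) ys)) _ ⟩
  sum (map g (map (x ,_) ys)) ℕ.+ sum (map g (cartesianProduct xs ys))
    ≡⟨ cong₂ ℕ._+_ (cong sum (sym (map-∘ ys))) (sum-map-cartesianProduct g xs ys) ⟩
  sum (map (λ y → g (x , y)) ys) ℕ.+ sum (map (λ x → sum (map (λ y → g (x , y)) ys)) xs) ∎
  where open ≡-Reasoning

indicator : {P : Set} → Dec P → ℕ
indicator (true  because _) = 1
indicator (false because _) = 0

card-True : {P : Set} (P? : Dec P) → True P? ↔ Fin (indicator P?)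
card-True (true  because _) = ↔-sym 1↔⊤
card-True (false because _) = ↔-sym 0↔⊥

length-filter : {A : Set} {P : A → Set} (P? : ∀ a → Dec (P a)) (xs : List A) →
                length (filter P? xs) ≡ sum (map (λ a → indicator (P? a)) xs)
length-filter P? []       = refl
length-filter P? (x ∷ xs) with P? x
... | true  because _ = cong suc (length-filter P? xs)
... | false because _ = length-filter P? xs

-- Sums over pairs of degrees.

sgn : ℕ → ℕ
sgn zero    = 0
sgn (suc _) = 1

-- Indicator that both factors of a product, of degrees k and k′, are nonconstant.
δ : ℕ → ℕ → ℕ
δ k k′ = sgn k ℕ.* sgn k′

sum-map-+ : {A : Set} (f g : A → ℕ) (xs : List A) → sum (map (λ x → f x ℕ.+ g x) xs) ≡ sum (map f xs) ℕ.+ sum (map g xs)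
sum-map-+ f g []       = refl
sum-map-+ f g (x ∷ xs) = trans (cong (f x ℕ.+ g x ℕ.+_) (sum-map-+ f g xs))
  (ℕS.solve 4 (λ a b c d → a ℕS.:+ b ℕS.:+ (c ℕS.:+ d) ℕS.:= a ℕS.:+ c ℕS.:+ (b ℕS.:+ d)) refl (f x) (g x) (sum (map f xs)) (sum (map g xs)))

sum-map-* : {A : Set} (c : ℕ) (f : A → ℕ) (xs : List A) → sum (map (λ x → c ℕ.* f x) xs) ≡ c ℕ.* sum (map f xs)
sum-map-* c f []       = sym (ℕₚ.*-zeroʳ c)
sum-map-* c f (x ∷ xs) = trans (cong (c ℕ.* f x ℕ.+_) (sum-map-* c f xs)) (sym (ℕₚ.*-distribˡ-+ c (f x) _))

sum-map-const : {A : Set} (c : ℕ) (xs : List A) → sum (map (λ _ → c) xs) ≡ length xs ℕ.* c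
sum-map-const c []       = refl
sum-map-const c (x ∷ xs) = cong (c ℕ.+_) (sum-map-const c xs)

-- Only the two extreme values of k, namely 0 and m + 1, contribute nothing. The term at 0 vanishes
-- by computation, so `go` starts at the index 1.
sum-δ : ∀ m → sum (map (λ k → δ k (suc m ∸ k)) (upTo (suc (suc m)))) ≡ m
sum-δ m = trans (cong sum (map-upTo (λ k → δ k (suc m ∸ k)) (suc (suc m)))) (go m)
  where
  go : ∀ m → sum (applyUpTo (λ k → δ (suc k) (m ∸ k)) (suc m)) ≡ m
  go zero    = refl
  go (suc m) = cong suc (go m)

-- The hypothesis is w = c - (c/q) δ′ without subtraction or division; it is summed termwise over
-- the square of `xs`.
double-sum : (w δ′ : ℕ → ℕ → ℕ) (q c : ℕ) (xs : List ℕ) → (∀ k l → q ℕ.* w k l ℕ.+ c ℕ.* δ′ k l ≡ c ℕ.* q) →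
  q ℕ.* sum (map (λ k → sum (map (w k) xs)) xs) ℕ.+ c ℕ.* sum (map (λ k → sum (map (δ′ k) xs)) xs) ≡ length xs ℕ.* (length xs ℕ.* (c ℕ.* q))
double-sum w δ′ q c xs h = begin
  q ℕ.* sum (map (λ k → sum (map (w k) xs)) xs) ℕ.+ c ℕ.* sum (map (λ k → sum (map (δ′ k) xs)) xs)
    ≡⟨ combine (λ k → sum (map (w k) xs)) (λ k → sum (map (δ′ k) xs)) ⟩
  sum (map (λ k → q ℕ.* sum (map (w k) xs) ℕ.+ c ℕ.* sum (map (δ′ k) xs)) xs)
    ≡⟨ cong sum (map-cong (λ k → trans (combine (w k) (δ′ k)) (trans (cong sum (map-cong (h k) xs)) (sum-map-const (c ℕ.* q) xs))) xs) ⟩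
  sum (map (λ _ → length xs ℕ.* (c ℕ.* q)) xs)
    ≡⟨ sum-map-const _ xs ⟩
  length xs ℕ.* (length xs ℕ.* (c ℕ.* q)) ∎
  where
  open ≡-Reasoning
  combine : ∀ f g → q ℕ.* sum (map f xs) ℕ.+ c ℕ.* sum (map g xs) ≡ sum (map (λ x → q ℕ.* f x ℕ.+ c ℕ.* g x) xs)
  combine f g = sym (trans (sum-map-+ (λ x → q ℕ.* f x) (λ x → c ℕ.* g x) xs) (cong₂ ℕ._+_ (sum-map-* q f xs) (sum-map-* c g xs)))

-- The commutative ring of polynomials, with equality up to trailing zeros.

module PolyRing (F : FiniteField) where
  open FiniteField F public
  open Poly F public
  open IsCommutativeRing isCommutativeRing using (+-assoc; +-comm; +-identityˡ; +-identityʳ; -‿inverseʳ; *-assoc; *-comm; *-identityˡ; *-identityʳ; zeroˡ; zeroʳ; distribˡ) public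

  fieldRing : CommutativeRing 0ℓ 0ℓ
  fieldRing = record { isCommutativeRing = isCommutativeRing }

  module 𝔽 = SemiringSolver (CommutativeRing.commutativeSemiring fieldRing)

  coeff : Pol → ℕ → Carrier
  coeff []      i       = 0#
  coeff (a ∷ p) zero    = a
  coeff (a ∷ p) (suc i) = coeff p i

  -- Equality up to trailing zeros.
  infix 4 _≈_
  record _≈_ (p q : Pol) : Set where
    constructor mk≈
    field at : ∀ i → coeff p i ≡ coeff q i
  open _≈_ public

  ≈-refl : ∀ {p} → p ≈ p
  ≈-refl = mk≈ λ _ → refl

  ≈-sym : ∀ {p q} → p ≈ q → q ≈ p
  ≈-sym e = mk≈ λ i → sym (at e i)

  ≈-trans : ∀ {p q r} → p ≈ q → q ≈ r → p ≈ r
  ≈-trans e f = mk≈ λ i → trans (at e i) (at f i)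

  negP : Pol → Pol
  negP = map (-_)

  scale : Carrier → Pol → Pol
  scale c = map (c *_)

  infixl 6 _⊕_
  infixl 7 _⊗_
  _⊕_ _⊗_ : Pol → Pol → Pol
  _⊕_ = addP
  _⊗_ = mulP

  -0≡0 : - 0# ≡ 0#
  -0≡0 = trans (sym (+-identityˡ (- 0#))) (-‿inverseʳ 0#)

  coeff-⊕ : ∀ p q i → coeff (p ⊕ q) i ≡ coeff p i + coeff q i
  coeff-⊕ []      q       i       = sym (+-identityˡ _)
  coeff-⊕ (a ∷ p) []      i       = sym (+-identityʳ _)
  coeff-⊕ (a ∷ p) (b ∷ q) zero    = refl
  coeff-⊕ (a ∷ p) (b ∷ q) (suc i) = coeff-⊕ p q i

  coeff-scale : ∀ c p i → coeff (scale c p) i ≡ c * coeff p i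
  coeff-scale c []      i       = sym (zeroʳ c)
  coeff-scale c (a ∷ p) zero    = refl
  coeff-scale c (a ∷ p) (suc i) = coeff-scale c p i

  coeff-negP : ∀ p i → coeff (negP p) i ≡ - coeff p i
  coeff-negP []      i       = sym -0≡0
  coeff-negP (a ∷ p) zero    = refl
  coeff-negP (a ∷ p) (suc i) = coeff-negP p i

  ∷-cong : ∀ {a b p q} → a ≡ b → p ≈ q → a ∷ p ≈ b ∷ q
  ∷-cong e f = mk≈ λ { zero → e ; (suc i) → at f i }

  0∷[]≈[] : 0# ∷ [] ≈ []
  0∷[]≈[] = mk≈ λ { zero → refl ; (suc i) → refl }

  ⊕-cong : ∀ {p p′ q q′} → p ≈ p′ → q ≈ q′ → p ⊕ q ≈ p′ ⊕ q′
  ⊕-cong {p} {p′} {q} {q′} e f = mk≈ λ i → begin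
    coeff (p ⊕ q) i          ≡⟨ coeff-⊕ p q i ⟩
    coeff p i + coeff q i    ≡⟨ cong₂ _+_ (at e i) (at f i) ⟩
    coeff p′ i + coeff q′ i  ≡⟨ coeff-⊕ p′ q′ i ⟨
    coeff (p′ ⊕ q′) i        ∎
    where open ≡-Reasoning

  ⊕-assoc : ∀ p q r → (p ⊕ q) ⊕ r ≈ p ⊕ (q ⊕ r)
  ⊕-assoc p q r = mk≈ λ i → begin
    coeff ((p ⊕ q) ⊕ r) i                ≡⟨ coeff-⊕ (p ⊕ q) r i ⟩
    coeff (p ⊕ q) i + coeff r i          ≡⟨ cong (_+ coeff r i) (coeff-⊕ p q i) ⟩
    coeff p i + coeff q i + coeff r i    ≡⟨ +-assoc _ _ _ ⟩
    coeff p i + (coeff q i + coeff r i)  ≡⟨ cong (coeff p i +_) (coeff-⊕ q r i) ⟨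
    coeff p i + coeff (q ⊕ r) i          ≡⟨ coeff-⊕ p (q ⊕ r) i ⟨
    coeff (p ⊕ (q ⊕ r)) i                ∎
    where open ≡-Reasoning

  ⊕-comm : ∀ p q → p ⊕ q ≈ q ⊕ p
  ⊕-comm p q = mk≈ λ i → trans (coeff-⊕ p q i) (trans (+-comm _ _) (sym (coeff-⊕ q p i)))

  ⊕-identityʳ : ∀ p → p ⊕ [] ≈ p
  ⊕-identityʳ p = ⊕-comm p []

  ⊕-inverseʳ : ∀ p → p ⊕ negP p ≈ []
  ⊕-inverseʳ p = mk≈ λ i →
    trans (coeff-⊕ p (negP p) i) (trans (cong (coeff p i +_) (coeff-negP p i)) (-‿inverseʳ _))

  negP-cong : ∀ {p q} → p ≈ q → negP p ≈ negP q
  negP-cong {p} {q} e = mk≈ λ i →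
    trans (coeff-negP p i) (trans (cong -_ (at e i)) (sym (coeff-negP q i)))

  scale-cong : ∀ c {p q} → p ≈ q → scale c p ≈ scale c q
  scale-cong c {p} {q} e = mk≈ λ i →
    trans (coeff-scale c p i) (trans (cong (c *_) (at e i)) (sym (coeff-scale c q i)))

  scale-⊕ : ∀ c p q → scale c (p ⊕ q) ≈ scale c p ⊕ scale c q
  scale-⊕ c p q = mk≈ λ i → begin
    coeff (scale c (p ⊕ q)) i                ≡⟨ coeff-scale c (p ⊕ q) i ⟩
    c * coeff (p ⊕ q) i                      ≡⟨ cong (c *_) (coeff-⊕ p q i) ⟩
    c * (coeff p i + coeff q i)              ≡⟨ distribˡ c _ _ ⟩
    c * coeff p i + c * coeff q i            ≡⟨ cong₂ _+_ (coeff-scale c p i) (coeff-scale c q i) ⟨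
    coeff (scale c p) i + coeff (scale c q) i  ≡⟨ coeff-⊕ (scale c p) (scale c q) i ⟨
    coeff (scale c p ⊕ scale c q) i          ∎
    where open ≡-Reasoning

  scale-scale : ∀ c d p → scale c (scale d p) ≈ scale (c * d) p
  scale-scale c d p = mk≈ λ i → begin
    coeff (scale c (scale d p)) i  ≡⟨ coeff-scale c (scale d p) i ⟩
    c * coeff (scale d p) i        ≡⟨ cong (c *_) (coeff-scale d p i) ⟩
    c * (d * coeff p i)            ≡⟨ *-assoc c d _ ⟨
    c * d * coeff p i              ≡⟨ coeff-scale (c * d) p i ⟨
    coeff (scale (c * d) p) i      ∎
    where open ≡-Reasoning

  scale-1 : ∀ p → scale 1# p ≈ p
  scale-1 p = mk≈ λ i → trans (coeff-scale 1# p i) (*-identityˡ _)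

  scale-0 : ∀ p → scale 0# p ≈ []
  scale-0 p = mk≈ λ i → trans (coeff-scale 0# p i) (zeroˡ _)

  shift-⊕ : ∀ p q → 0# ∷ (p ⊕ q) ≈ (0# ∷ p) ⊕ (0# ∷ q)
  shift-⊕ p q = ∷-cong (sym (+-identityˡ 0#)) ≈-refl

  scale-shift : ∀ c p → scale c (0# ∷ p) ≈ 0# ∷ scale c p
  scale-shift c p = ∷-cong (zeroʳ c) ≈-refl

  ⊗-congˡ : ∀ p {q q′} → q ≈ q′ → p ⊗ q ≈ p ⊗ q′
  ⊗-congˡ []      e = ≈-refl
  ⊗-congˡ (a ∷ p) e = ⊕-cong (scale-cong a e) (∷-cong refl (⊗-congˡ p e))

  ⊗-zeroʳ : ∀ p → p ⊗ [] ≈ []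
  ⊗-zeroʳ []      = ≈-refl
  ⊗-zeroʳ (a ∷ p) = ≈-trans (∷-cong refl (⊗-zeroʳ p)) 0∷[]≈[]

  interchange : ∀ p q r s → (p ⊕ q) ⊕ (r ⊕ s) ≈ (p ⊕ r) ⊕ (q ⊕ s)
  interchange p q r s = mk≈ λ i → begin
    coeff ((p ⊕ q) ⊕ (r ⊕ s)) i  ≡⟨ four p q r s i ⟩
    coeff p i + coeff q i + (coeff r i + coeff s i)  ≡⟨ 𝔽.solve 4 (λ a b c d → a :+ b :+ (c :+ d) := a :+ c :+ (b :+ d)) refl _ _ _ _ ⟩
    coeff p i + coeff r i + (coeff q i + coeff s i)  ≡⟨ four p r q s i ⟨
    coeff ((p ⊕ r) ⊕ (q ⊕ s)) i ∎
    where
    open ≡-Reasoning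
    open 𝔽 using (_:+_; _:=_)
    four : ∀ p q r s i → coeff ((p ⊕ q) ⊕ (r ⊕ s)) i ≡ coeff p i + coeff q i + (coeff r i + coeff s i)
    four p q r s i = trans (coeff-⊕ (p ⊕ q) (r ⊕ s) i) (cong₂ _+_ (coeff-⊕ p q i) (coeff-⊕ r s i))

  ⊗-distribˡ : ∀ p q r → p ⊗ (q ⊕ r) ≈ p ⊗ q ⊕ p ⊗ r
  ⊗-distribˡ []      q r = ≈-refl
  ⊗-distribˡ (a ∷ p) q r = ≈-trans
    (⊕-cong (scale-⊕ a q r) (≈-trans (∷-cong refl (⊗-distribˡ p q r)) (shift-⊕ (p ⊗ q) (p ⊗ r))))
    (interchange (scale a q) (scale a r) (0# ∷ p ⊗ q) (0# ∷ p ⊗ r))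

  -- `mulP` recurses on its left factor; this is the mirror recursion on the right factor, from
  -- which commutativity follows by induction.
  ⊗-∷ : ∀ p b q → p ⊗ (b ∷ q) ≈ scale b p ⊕ (0# ∷ p ⊗ q)
  ⊗-∷ []      b q = ≈-sym 0∷[]≈[]
  ⊗-∷ (a ∷ p) b q = ∷-cong (trans (+-identityʳ _) (trans (*-comm a b) (sym (+-identityʳ _))))
    (≈-trans (⊕-cong {scale a q} ≈-refl (⊗-∷ p b q)) (≈-trans (≈-sym (⊕-assoc (scale a q) (scale b p) _))
      (≈-trans (⊕-cong (⊕-comm (scale a q) (scale b p)) ≈-refl) (⊕-assoc (scale b p) (scale a q) _))))

  ⊗-comm : ∀ p q → p ⊗ q ≈ q ⊗ p
  ⊗-comm []      q = ≈-sym (⊗-zeroʳ q)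
  ⊗-comm (a ∷ p) q = ≈-trans (⊕-cong {scale a q} ≈-refl (∷-cong refl (⊗-comm p q))) (≈-sym (⊗-∷ q a p))

  -- Recursion on the left factor gives congruence only in the right one. Commutativity transports
  -- it to the left, where equal polynomials may be lists of different lengths.
  ⊗-cong : ∀ {p p′ q q′} → p ≈ p′ → q ≈ q′ → p ⊗ q ≈ p′ ⊗ q′
  ⊗-cong {p} {p′} {q} {q′} e f = ≈-trans (⊗-congˡ p f)
    (≈-trans (⊗-comm p q′) (≈-trans (⊗-congˡ q′ e) (⊗-comm q′ p′)))

  ⊗-distribʳ : ∀ r p q → (p ⊕ q) ⊗ r ≈ p ⊗ r ⊕ q ⊗ r
  ⊗-distribʳ r p q = ≈-trans (⊗-comm (p ⊕ q) r)
    (≈-trans (⊗-distribˡ r p q) (⊕-cong (⊗-comm r p) (⊗-comm r q)))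

  scale-⊗ : ∀ c p q → scale c p ⊗ q ≈ scale c (p ⊗ q)
  scale-⊗ c []      q = ≈-refl
  scale-⊗ c (a ∷ p) q = ≈-trans
    (⊕-cong (≈-sym (scale-scale c a q)) (≈-trans (∷-cong refl (scale-⊗ c p q)) (≈-sym (scale-shift c (p ⊗ q)))))
    (≈-sym (scale-⊕ c (scale a q) (0# ∷ p ⊗ q)))

  shift-⊗ : ∀ p q → (0# ∷ p) ⊗ q ≈ 0# ∷ p ⊗ q
  shift-⊗ p q = ⊕-cong (scale-0 q) ≈-refl

  ⊗-assoc : ∀ p q r → (p ⊗ q) ⊗ r ≈ p ⊗ (q ⊗ r)
  ⊗-assoc []      q r = ≈-refl
  ⊗-assoc (a ∷ p) q r = ≈-trans (⊗-distribʳ r (scale a q) (0# ∷ p ⊗ q))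
    (⊕-cong (scale-⊗ a q r) (≈-trans (shift-⊗ (p ⊗ q) r) (∷-cong refl (⊗-assoc p q r))))

  scale≈⊗ : ∀ c p → [ c ] ⊗ p ≈ scale c p
  scale≈⊗ c p = ≈-trans (⊕-cong {scale c p} ≈-refl 0∷[]≈[]) (⊕-identityʳ (scale c p))

  ⊗-identityˡ : ∀ p → [ 1# ] ⊗ p ≈ p
  ⊗-identityˡ p = ≈-trans (scale≈⊗ 1# p) (scale-1 p)

  polyRing : CommutativeRing 0ℓ 0ℓ
  polyRing = record
    { Carrier = Pol ; _≈_ = _≈_ ; _+_ = _⊕_ ; _*_ = _⊗_ ; -_ = negP ; 0# = [] ; 1# = [ 1# ]
    ; isCommutativeRing = record
      { isRing = record
        { +-isAbelianGroup = record
          { isGroup = record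
            { isMonoid = record
              { isSemigroup = record
                { isMagma = record
                  { isEquivalence = record { refl = ≈-refl ; sym = ≈-sym ; trans = ≈-trans }
                  ; ∙-cong = ⊕-cong }
                ; assoc = ⊕-assoc }
              ; identity = (λ p → ≈-refl) , ⊕-identityʳ }
            ; inverse = (λ p → ≈-trans (⊕-comm (negP p) p) (⊕-inverseʳ p)) , ⊕-inverseʳ
            ; ⁻¹-cong = negP-cong }
          ; comm = ⊕-comm }
        ; *-cong = ⊗-cong
        ; *-assoc = ⊗-assoc
        ; *-identity = ⊗-identityˡ , (λ p → ≈-trans (⊗-comm p [ 1# ]) (⊗-identityˡ p))
        ; distrib = ⊗-distribˡ , ⊗-distribʳ }
      ; *-comm = ⊗-comm } }

  module 𝔽[t] = SemiringSolver (CommutativeRing.commutativeSemiring polyRing)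

-- Degree bounds and division with remainder by monic polynomials.

module Division (F : FiniteField) where
  open PolyRing F public

  open 𝔽[t] using (_:+_; _:*_; _:=_)

  module ≈-Reasoning = SetoidReasoning (CommutativeRing.setoid polyRing)
  module 𝔾 = AbelianGroupProperties (CommutativeRing.+-abelianGroup polyRing)

  -- Degree below k is a condition on coefficients, not on the length of the list, so it respects
  -- `_≈_` and includes the zero polynomial without a convention.
  record Below (k : ℕ) (p : Pol) : Set where
    constructor mkBelow
    field above : ∀ i → k ≤ i → coeff p i ≡ 0#
  open Below public

  record Monic (k : ℕ) (p : Pol) : Set where
    constructor mkMonic
    field
      bounded : Below (suc k) p
      leading : coeff p k ≡ 1#
  open Monic public

  Below-resp : ∀ {k p q} → p ≈ q → Below k p → Below k q
  Below-resp e b = mkBelow λ i k≤i → trans (sym (at e i)) (above b i k≤i)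

  Below-mono : ∀ {j k p} → j ≤ k → Below j p → Below k p
  Below-mono j≤k b = mkBelow λ i k≤i → above b i (ℕₚ.≤-trans j≤k k≤i)

  Below-[] : ∀ {k} → Below k []
  Below-[] = mkBelow λ _ _ → refl

  Below-⊕ : ∀ {k p q} → Below k p → Below k q → Below k (p ⊕ q)
  Below-⊕ {k} {p} {q} b c = mkBelow λ i k≤i →
    trans (coeff-⊕ p q i) (trans (cong₂ _+_ (above b i k≤i) (above c i k≤i)) (+-identityˡ 0#))

  Below-negP : ∀ {k p} → Below k p → Below k (negP p)
  Below-negP {k} {p} b = mkBelow λ i k≤i →
    trans (coeff-negP p i) (trans (cong -_ (above b i k≤i)) -0≡0)

  Below-scale : ∀ {k p} c → Below k p → Below k (scale c p)
  Below-scale {k} {p} c b = mkBelow λ i k≤i →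
    trans (coeff-scale c p i) (trans (cong (c *_) (above b i k≤i)) (zeroʳ c))

  Below-0 : ∀ {p} → Below 0 p → p ≈ []
  Below-0 b = mk≈ λ i → above b i z≤n

  Below-∷ : ∀ {k a p} → Below k p → Below (suc k) (a ∷ p)
  Below-∷ b = mkBelow λ { (suc i) (s≤s k≤i) → above b i k≤i }

  Below-∷⁻ : ∀ {k a p} → Below (suc k) (a ∷ p) → Below k p
  Below-∷⁻ b = mkBelow λ i k≤i → above b (suc i) (s≤s k≤i)

  Below-length : ∀ p → Below (length p) p
  Below-length []      = Below-[]
  Below-length (a ∷ p) = Below-∷ (Below-length p)

  Below-lower : ∀ {k p} → Below (suc k) p → coeff p k ≡ 0# → Below k p
  Below-lower {k} {p} b e = mkBelow go
    where
    go : ∀ i → k ≤ i → coeff p i ≡ 0#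
    go i k≤i with ℕₚ.m≤n⇒m<n∨m≡n k≤i
    ... | inj₁ k<i  = above b i k<i
    ... | inj₂ refl = e

  -- The bounds are asymmetric, degree at most k against degree below j, so that j = 0 covers a
  -- vanishing second factor.
  Below-⊗ : ∀ {k j p q} → Below (suc k) p → Below j q → Below (k ℕ.+ j) (p ⊗ q)
  Below-⊗ {k} {j} {[]}    {q} b c = Below-[]
  Below-⊗ {zero} {j} {a ∷ p} {q} b c = Below-resp (≈-sym a∷p⊗q≈aq) (Below-scale a c)
    where
    a∷p⊗q≈aq : (a ∷ p) ⊗ q ≈ scale a q
    a∷p⊗q≈aq = ≈-trans (⊕-cong {scale a q} ≈-refl
      (≈-trans (∷-cong refl (⊗-cong (Below-0 (Below-∷⁻ b)) (≈-refl {q}))) 0∷[]≈[])) (⊕-identityʳ (scale a q))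
  Below-⊗ {suc k} {j} {a ∷ p} {q} b c = Below-⊕
    (Below-mono (ℕₚ.m≤n+m j (suc k)) (Below-scale a c)) (Below-∷ (Below-⊗ (Below-∷⁻ b) c))

  coeff-⊗-top : ∀ {k j p q} → Below (suc k) p → Below (suc j) q → coeff (p ⊗ q) (k ℕ.+ j) ≡ coeff p k * coeff q j
  coeff-⊗-top {k} {j} {[]} {q} b c = sym (zeroˡ _)
  coeff-⊗-top {zero} {j} {a ∷ p} {q} b c = begin
    coeff ((a ∷ p) ⊗ q) j  ≡⟨ at (⊗-cong (∷-cong {a} refl (Below-0 (Below-∷⁻ b))) (≈-refl {q})) j ⟩
    coeff ([ a ] ⊗ q) j    ≡⟨ at (scale≈⊗ a q) j ⟩
    coeff (scale a q) j    ≡⟨ coeff-scale a q j ⟩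
    a * coeff q j          ∎
    where open ≡-Reasoning
  coeff-⊗-top {suc k} {j} {a ∷ p} {q} b c = begin
    coeff ((a ∷ p) ⊗ q) (suc k ℕ.+ j)                       ≡⟨ coeff-⊕ (scale a q) (0# ∷ p ⊗ q) (suc k ℕ.+ j) ⟩
    coeff (scale a q) (suc k ℕ.+ j) + coeff (p ⊗ q) (k ℕ.+ j)
      ≡⟨ cong₂ _+_ (above (Below-scale a c) _ (s≤s (ℕₚ.m≤n+m j k))) (coeff-⊗-top (Below-∷⁻ b) c) ⟩
    0# + coeff p k * coeff q j                              ≡⟨ +-identityˡ _ ⟩
    coeff p k * coeff q j                                   ∎
    where open ≡-Reasoning

  Monic-resp : ∀ {k p q} → p ≈ q → Monic k p → Monic k q
  Monic-resp {k} e m = mkMonic (Below-resp e (bounded m)) (trans (sym (at e k)) (leading m))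

  Monic-⊕ : ∀ {k p r} → Monic k p → Below k r → Monic k (p ⊕ r)
  Monic-⊕ {k} {p} {r} m b = mkMonic
    (Below-⊕ (bounded m) (Below-mono (ℕₚ.n≤1+n k) b))
    (trans (coeff-⊕ p r k) (trans (cong₂ _+_ (leading m) (above b k ℕₚ.≤-refl)) (+-identityʳ 1#)))

  Monic-⊗ : ∀ {k j p q} → Monic k p → Monic j q → Monic (k ℕ.+ j) (p ⊗ q)
  Monic-⊗ {k} {j} {p} {q} m n = mkMonic
    (subst (λ d → Below d (p ⊗ q)) (ℕₚ.+-suc k j) (Below-⊗ (bounded m) (bounded n)))
    (trans (coeff-⊗-top (bounded m) (bounded n)) (trans (cong₂ _*_ (leading m) (leading n)) (*-identityˡ 1#)))

  -- The bound descends from the length of s one degree at a time: as a is monic, the coefficient of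
  -- s at its top degree l is that of a s at k + l, which vanishes as long as j ≤ l.
  Below-cancel : ∀ {k j a s} → Monic k a → Below (k ℕ.+ j) (a ⊗ s) → Below j s
  Below-cancel {k} {j} {a} {s} m b = descend (length s) (Below-length s)
    where
    descend : ∀ l → Below l s → Below j s
    descend zero    c = Below-mono z≤n c
    descend (suc l) c with j ℕ.≤? l
    ... | no  j≰l = Below-mono (ℕₚ.≰⇒> j≰l) c
    ... | yes j≤l = descend l (Below-lower c (begin
      coeff s l                ≡⟨ *-identityˡ _ ⟨
      1# * coeff s l           ≡⟨ cong (_* coeff s l) (leading m) ⟨
      coeff a k * coeff s l    ≡⟨ coeff-⊗-top (bounded m) c ⟨
      coeff (a ⊗ s) (k ℕ.+ l)  ≡⟨ above b _ (ℕₚ.+-monoʳ-≤ k j≤l) ⟩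
      0#                       ∎))
      where open ≡-Reasoning

  Monic-cancel : ∀ {k i a s} → Monic k a → Monic (k ℕ.+ i) (a ⊗ s) → Monic i s
  Monic-cancel {k} {i} {a} {s} m n = mkMonic b (begin
    coeff s i                ≡⟨ *-identityˡ _ ⟨
    1# * coeff s i           ≡⟨ cong (_* coeff s i) (leading m) ⟨
    coeff a k * coeff s i    ≡⟨ coeff-⊗-top (bounded m) b ⟨
    coeff (a ⊗ s) (k ℕ.+ i)  ≡⟨ leading n ⟩
    1#                       ∎)
    where
    open ≡-Reasoning
    b : Below (suc i) s
    b = Below-cancel m (subst (λ d → Below d (a ⊗ s)) (sym (ℕₚ.+-suc k i)) (bounded n))

  tailP : Pol → Pol
  tailP []      = []
  tailP (a ∷ p) = p

  coeff-tailP : ∀ p i → coeff (tailP p) i ≡ coeff p (suc i)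
  coeff-tailP []      i = refl
  coeff-tailP (a ∷ p) i = refl

  -- Missing coefficients are padded with 0. The same map inverts `toList` on polynomials of degree
  -- below k and `monic` on monic ones of degree k, where it drops the leading 1.
  vec : ∀ k → Pol → Vec Carrier k
  vec zero    p = []
  vec (suc k) p = coeff p 0 ∷ vec k (tailP p)

  vec-cong : ∀ k {p q} → p ≈ q → vec k p ≡ vec k q
  vec-cong zero            e = refl
  vec-cong (suc k) {p} {q} e = cong₂ _∷_ (at e 0)
    (vec-cong k (mk≈ λ i → trans (coeff-tailP p i) (trans (at e (suc i)) (sym (coeff-tailP q i)))))

  vec-toList : ∀ {k} (v : Vec Carrier k) → vec k (toList v) ≡ v
  vec-toList []      = refl
  vec-toList (a ∷ v) = cong (a ∷_) (vec-toList v)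

  vec-monic : ∀ {k} (v : Vec Carrier k) → vec k (monic v) ≡ v
  vec-monic []      = refl
  vec-monic (a ∷ v) = cong (a ∷_) (vec-monic v)

  Below-tailP : ∀ {k p} → Below (suc k) p → Below k (tailP p)
  Below-tailP {p = p} b = mkBelow λ i k≤i → trans (coeff-tailP p i) (above b (suc i) (s≤s k≤i))

  toList-vec : ∀ {k p} → Below k p → toList (vec k p) ≈ p
  toList-vec {zero}      b = ≈-sym (Below-0 b)
  toList-vec {suc k} {p} b = mk≈ λ
    { zero    → refl
    ; (suc i) → trans (at (toList-vec (Below-tailP b)) i) (coeff-tailP p i) }

  monic-vec : ∀ {k p} → Monic k p → monic (vec k p) ≈ p
  monic-vec {zero}      m = mk≈ λ
    { zero    → sym (leading m)
    ; (suc i) → sym (above (bounded m) (suc i) (s≤s z≤n)) }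
  monic-vec {suc k} {p} m = mk≈ λ
    { zero    → refl
    ; (suc i) → trans (at (monic-vec (mkMonic (Below-tailP (bounded m)) (trans (coeff-tailP p k) (leading m)))) i)
                      (coeff-tailP p i) }

  Below-toList : ∀ {k} (v : Vec Carrier k) → Below k (toList v)
  Below-toList []      = Below-[]
  Below-toList (a ∷ v) = Below-∷ (Below-toList v)

  Monic-monic : ∀ {k} (v : Vec Carrier k) → Monic k (monic v)
  Monic-monic []      = mkMonic (Below-∷ Below-[]) refl
  Monic-monic (a ∷ v) = mkMonic (Below-∷ (bounded (Monic-monic v))) (leading (Monic-monic v))

  toList-injective : ∀ {k} {v w : Vec Carrier k} → toList v ≈ toList w → v ≡ w
  toList-injective {k} {v} {w} e = trans (sym (vec-toList v)) (trans (vec-cong k e) (vec-toList w))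

  monic-injective : ∀ {k} {v w : Vec Carrier k} → monic v ≈ monic w → v ≡ w
  monic-injective {k} {v} {w} e = trans (sym (vec-monic v)) (trans (vec-cong k e) (vec-monic w))

  vec-injective-Monic : ∀ {k p q} → Monic k p → Monic k q → vec k p ≡ vec k q → p ≈ q
  vec-injective-Monic m n e = ≈-trans (≈-sym (monic-vec m))
    (subst (λ v → monic v ≈ _) (sym e) (monic-vec n))

  -- Synthetic division by A = `monic a`. If p = A s + r, then c + t p = A (t s) + (c + t r). The
  -- carry c + t r has degree at most k; subtracting d A, with d its coefficient at k, leaves the
  -- remainder and makes d + t s the quotient.
  quot : ∀ {k} → Vec Carrier k → Pol → Pol
  rem  : ∀ {k} → Vec Carrier k → Pol → Vec Carrier k

  -- The remainder of c + t p before its coefficient of degree k is cleared.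
  carry : ∀ {k} → Vec Carrier k → Carrier → Pol → Pol
  carry a c p = c ∷ toList (rem a p)

  quot         a []      = []
  quot {k = k} a (c ∷ p) = coeff (carry a c p) k ∷ quot a p

  rem {k} a []      = vec k []
  rem {k} a (c ∷ p) = vec k (carry a c p ⊕ negP (scale (coeff (carry a c p) k) (monic a)))

  Below-reduced : ∀ {k} (a : Vec Carrier k) {p} → Below (suc k) p →
                  Below k (p ⊕ negP (scale (coeff p k) (monic a)))
  Below-reduced {k} a {p} b = Below-lower
    (Below-⊕ b (Below-negP (Below-scale _ (bounded (Monic-monic a))))) (begin
      coeff (p ⊕ negP (scale c (monic a))) k      ≡⟨ coeff-⊕ p _ k ⟩
      c + coeff (negP (scale c (monic a))) k      ≡⟨ cong (c +_) (coeff-negP (scale c (monic a)) k) ⟩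
      c + - coeff (scale c (monic a)) k           ≡⟨ cong (λ x → c + - x) (coeff-scale c (monic a) k) ⟩
      c + - (c * coeff (monic a) k)               ≡⟨ cong (λ x → c + - (c * x)) (leading (Monic-monic a)) ⟩
      c + - (c * 1#)                              ≡⟨ cong (λ x → c + - x) (*-identityʳ c) ⟩
      c + - c                                     ≡⟨ -‿inverseʳ c ⟩
      0#                                          ∎)
    where
    open ≡-Reasoning
    c = coeff p k

  division : ∀ {k} (a : Vec Carrier k) p → p ≈ monic a ⊗ quot a p ⊕ toList (rem a p)
  division {k} a [] = ≈-sym (≈-trans (⊕-cong (⊗-zeroʳ (monic a)) (toList-vec {k} Below-[])) ≈-refl)
  division {k} a (c ∷ p) = begin
    c ∷ p                                              ≈⟨ ∷-cong (sym (+-identityˡ c)) (division a p) ⟩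
    (0# ∷ A ⊗ s) ⊕ ρ                                   ≈⟨ ⊕-cong {0# ∷ A ⊗ s} ≈-refl (⊕-identityʳ ρ) ⟨
    -- Insert d A - d A: the first term completes the quotient, the second clears degree k of the
    -- carry.
    (0# ∷ A ⊗ s) ⊕ (ρ ⊕ [])                            ≈⟨ ⊕-cong {0# ∷ A ⊗ s} ≈-refl (⊕-cong {ρ} ≈-refl (⊕-inverseʳ (scale d A))) ⟨
    (0# ∷ A ⊗ s) ⊕ (ρ ⊕ (scale d A ⊕ negP (scale d A)))
      ≈⟨ 𝔽[t].solve 4 (λ x y z w → x :+ (y :+ (z :+ w)) := (z :+ x) :+ (y :+ w)) ≈-refl
           (0# ∷ A ⊗ s) ρ (scale d A) (negP (scale d A)) ⟩
    (scale d A ⊕ (0# ∷ A ⊗ s)) ⊕ (ρ ⊕ negP (scale d A)) ≈⟨ ⊕-cong (⊗-∷ A d s) (toList-vec (Below-reduced a (Below-∷ (Below-toList (rem a p))))) ⟨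
    A ⊗ quot a (c ∷ p) ⊕ toList (rem a (c ∷ p))        ∎
    where
    open ≈-Reasoning
    A = monic a
    s = quot a p
    ρ = carry a c p
    d = coeff ρ k

  -- The product a (s - s′) = r′ - r has degree below k, so cancelling the monic a leaves s - s′ of
  -- degree below 0, that is zero.
  division-unique : ∀ {k a s s′ r r′} → Monic k a → Below k r → Below k r′ →
                    a ⊗ s ⊕ r ≈ a ⊗ s′ ⊕ r′ → s ≈ s′ × r ≈ r′
  division-unique {k} {a} {s} {s′} {r} {r′} m b b′ e = s≈s′ , 𝔾.∙-cancelˡ (a ⊗ s) r r′
      (≈-trans e (⊕-cong (⊗-congˡ a (≈-sym s≈s′)) (≈-refl {r′})))
    where
    open ≈-Reasoning
    d = s ⊕ negP s′
    ad+r≈r′ : a ⊗ d ⊕ r ≈ r′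
    ad+r≈r′ = begin
      a ⊗ d ⊕ r                      ≈⟨ 𝔽[t].solve 4 (λ a s t r → a :* (s :+ t) :+ r := a :* s :+ r :+ a :* t) ≈-refl a s (negP s′) r ⟩
      a ⊗ s ⊕ r ⊕ a ⊗ negP s′        ≈⟨ ⊕-cong e (≈-refl {a ⊗ negP s′}) ⟩
      a ⊗ s′ ⊕ r′ ⊕ a ⊗ negP s′      ≈⟨ 𝔽[t].solve 4 (λ a s t r → a :* s :+ r :+ a :* t := a :* (s :+ t) :+ r) ≈-refl a s′ (negP s′) r′ ⟩
      a ⊗ (s′ ⊕ negP s′) ⊕ r′        ≈⟨ ⊕-cong (≈-trans (⊗-congˡ a (⊕-inverseʳ s′)) (⊗-zeroʳ a)) (≈-refl {r′}) ⟩
      r′                             ∎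
    ad≈ : a ⊗ d ≈ r′ ⊕ negP r
    ad≈ = begin
      a ⊗ d                  ≈⟨ ⊕-identityʳ (a ⊗ d) ⟨
      a ⊗ d ⊕ []             ≈⟨ ⊕-cong {a ⊗ d} ≈-refl (⊕-inverseʳ r) ⟨
      a ⊗ d ⊕ (r ⊕ negP r)   ≈⟨ ⊕-assoc (a ⊗ d) r (negP r) ⟨
      a ⊗ d ⊕ r ⊕ negP r     ≈⟨ ⊕-cong ad+r≈r′ (≈-refl {negP r}) ⟩
      r′ ⊕ negP r            ∎
    d≈0 : d ≈ []
    d≈0 = Below-0 (Below-cancel m (subst (λ j → Below j (a ⊗ d)) (sym (ℕₚ.+-identityʳ k))
      (Below-resp (≈-sym ad≈) (Below-⊕ b′ (Below-negP b)))))
    s≈s′ : s ≈ s′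
    s≈s′ = 𝔾.∙-cancelʳ (negP s′) s s′ (≈-trans d≈0 (≈-sym (⊕-inverseʳ s′)))

  infix 4 _∣_
  -- Divisibility as a vanishing remainder, an equation between vectors, is proof-irrelevant, so
  -- that dependent sums over it count solutions only once.
  record _∣_ {k} (a : Vec Carrier k) (p : Pol) : Set where
    constructor divides
    field rem≡0 : rem a p ≡ vec k []
  open _∣_ public

  ∣⇒≈ : ∀ {k} (a : Vec Carrier k) {p} → a ∣ p → p ≈ monic a ⊗ quot a p
  ∣⇒≈ {k} a {p} d = ≈-trans (division a p) (≈-trans
    (⊕-cong {monic a ⊗ quot a p} ≈-refl (subst (λ r → toList r ≈ []) (sym (rem≡0 d)) (toList-vec {k} Below-[])))
    (⊕-identityʳ (monic a ⊗ quot a p)))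

  ≈⇒∣ : ∀ {k} (a : Vec Carrier k) {p} s → p ≈ monic a ⊗ s → a ∣ p
  ≈⇒∣ {k} a {p} s e = divides (toList-injective (≈-trans
    (proj₂ (division-unique {s = quot a p} {s′ = s} (Monic-monic a) (Below-toList (rem a p)) Below-[]
      (≈-trans (≈-sym (division a p)) (≈-trans e (≈-sym (⊕-identityʳ (monic a ⊗ s)))))))
    (≈-sym (toList-vec {k} Below-[]))))

  ∣-resp : ∀ {k} (a : Vec Carrier k) {p q} → p ≈ q → a ∣ p → a ∣ q
  ∣-resp a {p} e d = ≈⇒∣ a (quot a p) (≈-trans (≈-sym e) (∣⇒≈ a d))

  ∣-irrelevant : ∀ {k} (a : Vec Carrier k) {p} (d d′ : a ∣ p) → d ≡ d′
  ∣-irrelevant a d d′ = cong divides (≡-irrelevant (rem≡0 d) (rem≡0 d′))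

-- Congruences modulo a monic polynomial and the Euclidean algorithm.

module Congruences (F : FiniteField) where
  open Division F public
  open 𝔽[t] using (_:+_; _:*_; _:=_)
  open import Data.Nat using (_^_)

  ∣-+-multiple : ∀ {k} (a : Vec Carrier k) {p} y → a ∣ p → a ∣ p ⊕ monic a ⊗ y
  ∣-+-multiple a {p} y d = ≈⇒∣ a (quot a p ⊕ y)
    (≈-trans (⊕-cong (∣⇒≈ a d) (≈-refl {monic a ⊗ y})) (≈-sym (⊗-distribˡ (monic a) (quot a p) y)))

  ∣-drop-multiple : ∀ {k} (a : Vec Carrier k) {p} y → a ∣ p ⊕ monic a ⊗ y → a ∣ p
  ∣-drop-multiple a {p} y d = ∣-resp a cancel (∣-+-multiple a (negP y) d)
    where
    open ≈-Reasoning
    A = monic a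
    cancel : p ⊕ A ⊗ y ⊕ A ⊗ negP y ≈ p
    cancel = begin
      p ⊕ A ⊗ y ⊕ A ⊗ negP y    ≈⟨ 𝔽[t].solve 4 (λ p a y z → p :+ a :* y :+ a :* z := p :+ a :* (y :+ z)) ≈-refl p A y (negP y) ⟩
      p ⊕ A ⊗ (y ⊕ negP y)      ≈⟨ ⊕-cong {p} ≈-refl (≈-trans (⊗-congˡ A (⊕-inverseʳ y)) (⊗-zeroʳ A)) ⟩
      p ⊕ []                    ≈⟨ ⊕-identityʳ p ⟩
      p                         ∎

  quot-unique : ∀ {k} (a : Vec Carrier k) {p} s → p ≈ monic a ⊗ s → quot a p ≈ s
  quot-unique a {p} s e = proj₁ (division-unique {s = quot a p} {s′ = s} (Monic-monic a) (Below-toList (rem a p)) Below-[]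
    (≈-trans (≈-sym (division a p)) (≈-trans e (≈-sym (⊕-identityʳ (monic a ⊗ s))))))

  module _ {k i : ℕ} (a : Vec Carrier k) {Q : Pol → Set} (Q-irrelevant : ∀ p → Irrelevant (Q p))
           (Q⇒ : ∀ {p s r} → p ≈ monic a ⊗ s ⊕ r → Q p → Q r)
           (Q⇐ : ∀ {p s r} → p ≈ monic a ⊗ s ⊕ r → Q r → Q p) where

    -- Division b = a s + r matches monic b with pairs of a monic s and a reduced r. Since Q depends
    -- only on the residue class modulo a, the quotient s is unconstrained.
    Σ-division : Σ (Vec Carrier (k ℕ.+ i)) (Q ∘ monic) ↔ (Vec Carrier i × Σ (Vec Carrier k) (Q ∘ toList))
    Σ-division = ↔-trans
      (subset↔ {Q = λ (_ , r) → Q (toList r)} (λ _ → Q-irrelevant _) (λ _ → Q-irrelevant _) f g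
        (λ b → Q⇒ (division a (monic b))) (λ (s , r) → Q⇐ (g-correct s r)) (λ (s , r) _ → fg s r) (λ b _ → gf b))
      Σ-assoc
      where
      f : Vec Carrier (k ℕ.+ i) → Vec Carrier i × Vec Carrier k
      f b = vec i (quot a (monic b)) , rem a (monic b)
      g : Vec Carrier i × Vec Carrier k → Vec Carrier (k ℕ.+ i)
      g (s , r) = vec (k ℕ.+ i) (monic a ⊗ monic s ⊕ toList r)
      g-correct : ∀ s r → monic (g (s , r)) ≈ monic a ⊗ monic s ⊕ toList r
      g-correct s r = monic-vec (Monic-⊕ (Monic-⊗ (Monic-monic a) (Monic-monic s))
                                         (Below-mono (ℕₚ.m≤m+n k i) (Below-toList r)))
      fg : ∀ s r → f (g (s , r)) ≡ (s , r)
      fg s r = cong₂ _,_ (trans (vec-cong i (proj₁ u)) (vec-monic s)) (toList-injective (proj₂ u))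
        where
        u : quot a (monic (g (s , r))) ≈ monic s × toList (rem a (monic (g (s , r)))) ≈ toList r
        u = division-unique (Monic-monic a) (Below-toList (rem a (monic (g (s , r))))) (Below-toList r)
              (≈-trans (≈-sym (division a (monic (g (s , r))))) (g-correct s r))
      -- The product of a and the quotient is b - r with r of degree below k ≤ k + i, hence monic of
      -- degree k + i.
      Monic-quot : ∀ b → Monic i (quot a (monic b))
      Monic-quot b = Monic-cancel (Monic-monic a) (Monic-resp (≈-sym as≈)
          (Monic-⊕ (Monic-monic b) (Below-negP (Below-mono (ℕₚ.m≤m+n k i) (Below-toList (rem a (monic b)))))))
        where
        open ≈-Reasoning
        as = monic a ⊗ quot a (monic b)
        r  = toList (rem a (monic b))
        as≈ : as ≈ monic b ⊕ negP r
        as≈ = begin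
          as                   ≈⟨ ⊕-identityʳ as ⟨
          as ⊕ []              ≈⟨ ⊕-cong {as} ≈-refl (⊕-inverseʳ r) ⟨
          as ⊕ (r ⊕ negP r)    ≈⟨ ⊕-assoc as r (negP r) ⟨
          as ⊕ r ⊕ negP r      ≈⟨ ⊕-cong (division a (monic b)) (≈-refl {negP r}) ⟨
          monic b ⊕ negP r     ∎
      gf : ∀ b → g (f b) ≡ b
      gf b = trans (vec-cong (k ℕ.+ i) (≈-trans
          (⊕-cong (⊗-congˡ (monic a) (monic-vec (Monic-quot b))) (≈-refl {toList (rem a (monic b))}))
          (≈-sym (division a (monic b))))) (vec-monic b)

  private
    ⊗-reduce : ∀ {k} (a : Vec Carrier k) c e {p s r} → p ≈ monic a ⊗ s ⊕ r →
               c ⊗ p ⊕ e ≈ c ⊗ r ⊕ e ⊕ monic a ⊗ (s ⊗ c)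
    ⊗-reduce a c e {p} {s} {r} h = ≈-trans (⊕-cong (⊗-congˡ c h) (≈-refl {e}))
      (𝔽[t].solve 5 (λ a c e s r → c :* (a :* s :+ r) :+ e := c :* r :+ e :+ a :* (s :* c)) ≈-refl (monic a) c e s r)

  -- The residue of c b + e modulo a depends only on that of b, because c (a s + r) + e and c r + e
  -- differ by a multiple of a.
  Σ-division-∣ : ∀ {k} i (a : Vec Carrier k) (c e : Pol) →
    (Σ (Vec Carrier (k ℕ.+ i)) λ b → a ∣ c ⊗ monic b ⊕ e) ↔ (Vec Carrier i × Σ (Vec Carrier k) λ r → a ∣ c ⊗ toList r ⊕ e)
  Σ-division-∣ i a c e = Σ-division a {λ p → a ∣ c ⊗ p ⊕ e} (λ _ → ∣-irrelevant a)
    (λ {p} {s} {r} h d → ∣-drop-multiple a (s ⊗ c) (∣-resp a (⊗-reduce a c e h) d))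
    (λ {p} {s} {r} h d → ∣-resp a (≈-sym (⊗-reduce a c e h)) (∣-+-multiple a (s ⊗ c) d))

  -- Stated through `True` to be irrelevant and to be counted by `card-True`.
  Nonzero : Carrier → Set
  Nonzero u = True (¬? (u ≟ 0#))

  Units : Set
  Units = Σ Carrier λ u → Nonzero u

  -- Solutions of a ∣ r v + e with a monic of degree k and v reduced modulo a:
  -- in U the polynomial r has degree below i, in W it is monic of degree i.
  U W : (k i : ℕ) → Carrier → Set
  U k i e = Σ (Vec Carrier k) λ a → Σ (Vec Carrier i) λ r → Σ (Vec Carrier k) λ v → a ∣ toList r ⊗ toList v ⊕ [ e ]
  W k i e = Σ (Vec Carrier k) λ a → Σ (Vec Carrier i) λ r → Σ (Vec Carrier k) λ v → a ∣ monic r ⊗ toList v ⊕ [ e ]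

  -- The equation b x + e = a a′ with the cofactor a′ left implicit.
  Y : (k l l′ : ℕ) → Carrier → Set
  Y k l l′ e = Σ (Vec Carrier k) λ a → Σ (Vec Carrier l) λ b → Σ (Vec Carrier l′) λ x → a ∣ monic b ⊗ monic x ⊕ [ e ]

  ∣-cong↔ : ∀ {k} (a : Vec Carrier k) {p q} → p ≈ q → (a ∣ p) ↔ (a ∣ q)
  ∣-cong↔ a e = proposition↔ (∣-irrelevant a) (∣-irrelevant a) (∣-resp a e) (∣-resp a (≈-sym e))

  Y↔W : ∀ k l j e → Y k l (k ℕ.+ j) e ↔ (Vec Carrier j × W k l e)
  Y↔W k l j e = ↔-trans (Σ-cong λ a → ↔-trans (Σ-cong λ b → Σ-division-∣ j a (monic b) [ e ]) Σ-pull) Σ-pull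

  -- Here the monic factor r is divided by a. The product is commuted before and after, because
  -- `Σ-division-∣` reduces the right factor.
  W↔U : ∀ k i e → W k (k ℕ.+ i) e ↔ (Vec Carrier i × U k k e)
  W↔U k i e = ↔-trans (Σ-cong λ a → ↔-trans Σ-swap (↔-trans (Σ-cong λ v →
      ↔-trans (Σ-cong λ r → ∣-cong↔ a (swap⊗ (monic r) (toList v)))
      (↔-trans (Σ-division-∣ i a (toList v) [ e ])
               (↔-refl ×-↔ Σ-cong λ r → ∣-cong↔ a (swap⊗ (toList v) (toList r)))))
      (↔-trans Σ-pull (↔-refl ×-↔ Σ-swap)))) Σ-pull
    where
    swap⊗ : ∀ p q → p ⊗ q ⊕ [ e ] ≈ q ⊗ p ⊕ [ e ]
    swap⊗ p q = ⊕-cong (⊗-comm p q) (≈-refl {[ e ]})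

  cancel-const : ∀ p {c d} → c + d ≡ 0# → p ⊕ [ c ] ⊕ [ d ] ≈ p
  cancel-const p {c} {d} c+d≡0 = ≈-trans (⊕-assoc p [ c ] [ d ])
    (≈-trans (⊕-cong {p} ≈-refl (≈-trans (∷-cong c+d≡0 ≈-refl) 0∷[]≈[])) (⊕-identityʳ p))

  -- The Euclidean exchange of moduli: r v + c = a w gives a w + d = r v with d = -c, so r divides a
  -- w + d, and the quotient of that division is v again.
  module Flip {k i : ℕ} (a : Vec Carrier k) (r : Vec Carrier i) (1≤k+i : 1 ≤ k ℕ.+ i) {c d : Carrier} (c+d≡0 : c + d ≡ 0#)
              (v : Vec Carrier k) (a∣ : a ∣ monic r ⊗ toList v ⊕ [ c ]) where
    A = monic a
    R = monic r
    p = R ⊗ toList v ⊕ [ c ]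
    w = vec i (quot a p)

    -- The product r v has degree below i + k, and `1≤k+i` puts the constant c under the same bound.
    -- Cancelling a then bounds the quotient by i, so `vec i` loses nothing.
    Below-p : Below (k ℕ.+ i) p
    Below-p = Below-⊕ (subst (λ j → Below j (R ⊗ toList v)) (ℕₚ.+-comm i k) (Below-⊗ (bounded (Monic-monic r)) (Below-toList v)))
                      (Below-mono 1≤k+i (Below-length [ c ]))

    p≈Aw : p ≈ A ⊗ toList w
    p≈Aw = ≈-trans (∣⇒≈ a a∣) (⊗-congˡ A (≈-sym (toList-vec (Below-cancel (Monic-monic a) (Below-resp (∣⇒≈ a a∣) Below-p)))))

    Aw+d≈Rv : A ⊗ toList w ⊕ [ d ] ≈ R ⊗ toList v
    Aw+d≈Rv = ≈-trans (⊕-cong (≈-sym p≈Aw) (≈-refl {[ d ]})) (cancel-const (R ⊗ toList v) c+d≡0)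

    flipped : r ∣ A ⊗ toList w ⊕ [ d ]
    flipped = ≈⇒∣ r (toList v) Aw+d≈Rv

    back : vec k (quot r (A ⊗ toList w ⊕ [ d ])) ≡ v
    back = trans (vec-cong k (quot-unique r (toList v) Aw+d≈Rv)) (vec-toList v)

  W-flip : ∀ k i → 1 ≤ k ℕ.+ i → ∀ {c d} → c + d ≡ 0# → W k i c ↔ W i k d
  W-flip k i 1≤ {c} {d} c+d≡0 = ↔-trans (Σ-cong λ a → Σ-cong λ r →
      subset↔ (λ _ → ∣-irrelevant a) (λ _ → ∣-irrelevant r)
        (λ v → vec i (quot a (monic r ⊗ toList v ⊕ [ c ])))
        (λ w → vec k (quot r (monic a ⊗ toList w ⊕ [ d ])))
        (λ v h → Flip.flipped a r 1≤ c+d≡0 v h)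
        (λ w h → Flip.flipped r a 1≤′ d+c≡0 w h)
        (λ w h → Flip.back r a 1≤′ d+c≡0 w h)
        (λ v h → Flip.back a r 1≤ c+d≡0 v h))
    Σ-swap
    where
    1≤′ : 1 ≤ i ℕ.+ k
    1≤′ = subst (1 ≤_) (ℕₚ.+-comm k i) 1≤
    d+c≡0 : d + c ≡ 0#
    d+c≡0 = trans (+-comm d c) c+d≡0

  -- A polynomial of degree at most i either has degree below i or is a unit times a monic one of degree i.
  value : ∀ {i} → Vec Carrier i ⊎ (Units × Vec Carrier i) → Pol
  value (inj₁ r)             = toList r
  value (inj₂ ((u , _) , r)) = scale u (monic r)

  inv : ∀ {u} → Nonzero u → Carrier
  inv {u} nz = proj₁ (inverse u (toWitness nz))

  inv-inverseʳ : ∀ {u} (nz : Nonzero u) → u * inv nz ≡ 1#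
  inv-inverseʳ {u} nz = proj₂ (inverse u (toWitness nz))

  inv-inverseˡ : ∀ {u} (nz : Nonzero u) → inv nz * u ≡ 1#
  inv-inverseˡ nz = trans (*-comm _ _) (inv-inverseʳ nz)

  scale-cancel : ∀ {c d} p → c * d ≡ 1# → scale c (scale d p) ≈ p
  scale-cancel {c} {d} p e = ≈-trans (scale-scale c d p) (subst (λ x → scale x p ≈ p) (sym e) (scale-1 p))

  module _ {i : ℕ} where

    normalise : Vec Carrier (suc i) → Vec Carrier i ⊎ (Units × Vec Carrier i)
    normalise r with coeff (toList r) i ≟ 0#
    ... | yes _ = inj₁ (vec i (toList r))
    ... | no nz = inj₂ ((coeff (toList r) i , fromWitness nz) ,
                        vec i (scale (inv (fromWitness {a? = ¬? (coeff (toList r) i ≟ 0#)} nz)) (toList r)))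

    value-normalise : ∀ r → value (normalise r) ≈ toList r
    value-normalise r with coeff (toList r) i ≟ 0#
    ... | yes z = toList-vec (Below-lower (Below-toList r) z)
    ... | no nz = ≈-trans (scale-cong u (monic-vec (mkMonic (Below-scale (inv fz) (Below-toList r))
                    (trans (coeff-scale (inv fz) (toList r) i) (inv-inverseˡ fz)))))
                    (scale-cancel (toList r) (inv-inverseʳ fz))
      where
      u = coeff (toList r) i
      fz : Nonzero u
      fz = fromWitness nz

    Below-value : ∀ x → Below (suc i) (value x)
    Below-value (inj₁ r)             = Below-mono (ℕₚ.n≤1+n i) (Below-toList r)
    Below-value (inj₂ ((u , _) , r)) = Below-scale u (bounded (Monic-monic r))

    coeff-value : ∀ u (r : Vec Carrier i) → coeff (scale u (monic r)) i ≡ u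
    coeff-value u r = trans (coeff-scale u (monic r) i) (trans (cong (u *_) (leading (Monic-monic r))) (*-identityʳ u))

    -- The coefficient at degree i separates the two cases and recovers the unit u.
    value-injective : ∀ x y → value x ≈ value y → x ≡ y
    value-injective (inj₁ r) (inj₁ s) e = cong inj₁ (toList-injective e)
    value-injective (inj₁ r) (inj₂ ((u , nz) , s)) e = ⊥-elim (toWitness nz
      (trans (sym (coeff-value u s)) (trans (sym (at e i)) (above (Below-toList r) i ℕₚ.≤-refl))))
    value-injective (inj₂ ((u , nz) , r)) (inj₁ s) e = ⊥-elim (toWitness nz
      (trans (sym (coeff-value u r)) (trans (at e i) (above (Below-toList s) i ℕₚ.≤-refl))))
    value-injective (inj₂ ((u , nz) , r)) (inj₂ ((u′ , nz′) , s)) e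
      with trans (sym (coeff-value u r)) (trans (at e i) (coeff-value u′ s))
    ... | refl = cong₂ (λ z v → inj₂ ((u , z) , v)) (T-irrelevant nz nz′)
      (monic-injective (≈-trans (≈-sym (scale-cancel (monic r) (inv-inverseˡ nz)))
        (≈-trans (scale-cong (inv nz) e) (scale-cancel (monic s) (inv-inverseˡ nz)))))

    Vec-suc↔ : Vec Carrier (suc i) ↔ (Vec Carrier i ⊎ (Units × Vec Carrier i))
    Vec-suc↔ = mk↔ₛ′ normalise (λ x → vec (suc i) (value x))
      (λ x → value-injective _ x (≈-trans (value-normalise (vec (suc i) (value x))) (toList-vec (Below-value x))))
      (λ r → trans (vec-cong (suc i) (value-normalise r)) (vec-toList r))

  -- The unit moves from one factor to the other, (u p) v = p (u v), and v ↦ u v permutes the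
  -- polynomials of degree below k.
  Σ-scale : ∀ {k} (a : Vec Carrier k) {u} (nz : Nonzero u) p e →
            (Σ (Vec Carrier k) λ v → a ∣ scale u p ⊗ toList v ⊕ e) ↔ (Σ (Vec Carrier k) λ v → a ∣ p ⊗ toList v ⊕ e)
  Σ-scale {k} a {u} nz p e = subset↔ (λ _ → ∣-irrelevant a) (λ _ → ∣-irrelevant a)
    (scaleV u) (scaleV (inv nz))
    (λ v → ∣-resp a (⊕-cong (move u v) (≈-refl {e})))
    (λ v → ∣-resp a (⊕-cong (≈-sym (≈-trans (move u (scaleV (inv nz) v)) (⊗-congˡ p (subst (λ w → toList w ≈ toList v) (sym (scaleV-cancel v (inv-inverseʳ nz))) ≈-refl)))) (≈-refl {e})))
    (λ v _ → scaleV-cancel v (inv-inverseʳ nz))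
    (λ v _ → scaleV-cancel v (inv-inverseˡ nz))
    where
    scaleV : Carrier → Vec Carrier k → Vec Carrier k
    scaleV c v = vec k (scale c (toList v))
    toList-scaleV : ∀ c v → toList (scaleV c v) ≈ scale c (toList v)
    toList-scaleV c v = toList-vec (Below-scale c (Below-toList v))
    move : ∀ c v → scale c p ⊗ toList v ≈ p ⊗ toList (scaleV c v)
    move c v = begin
      scale c p ⊗ toList v           ≈⟨ scale-⊗ c p (toList v) ⟩
      scale c (p ⊗ toList v)         ≈⟨ scale-cong c (⊗-comm p (toList v)) ⟩
      scale c (toList v ⊗ p)         ≈⟨ scale-⊗ c (toList v) p ⟨
      scale c (toList v) ⊗ p         ≈⟨ ⊗-comm (scale c (toList v)) p ⟩
      p ⊗ scale c (toList v)         ≈⟨ ⊗-congˡ p (toList-scaleV c v) ⟨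
      p ⊗ toList (scaleV c v)        ∎
      where open ≈-Reasoning
    scaleV-cancel : ∀ {c d} v → c * d ≡ 1# → scaleV c (scaleV d v) ≡ v
    scaleV-cancel {c} {d} v h = trans (vec-cong k (≈-trans (scale-cong c (toList-scaleV d v)) (scale-cancel (toList v) h))) (vec-toList v)

  -- Split r by its coefficient at degree i; when that is a unit, r is made monic and the unit is
  -- absorbed into v.
  U-suc : ∀ k i e → U k (suc i) e ↔ (U k i e ⊎ (Units × W k i e))
  U-suc k i e = ↔-trans (Σ-cong λ a → ↔-trans
      (Σ-↔ {B = λ x → Σ (Vec Carrier k) λ v → a ∣ value x ⊗ toList v ⊕ [ e ]} Vec-suc↔
        (λ {r} → Σ-cong λ v → ∣-cong↔ a (⊕-cong (⊗-cong (≈-sym (value-normalise r)) (≈-refl {toList v})) (≈-refl {[ e ]}))))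
      (↔-trans Σ-distribʳ-⊎ (↔-refl ⊎-↔
        ↔-trans Σ-assoc (Σ-cong λ (u , nz) → Σ-cong λ r → Σ-scale a nz (monic r) [ e ]))))
    (↔-trans Σ-distribˡ-⊎ (↔-refl ⊎-↔ Σ-swap))

  -- Here r = 0, so a of positive degree would divide the constant e. The quotient then has degree
  -- below 0, hence is zero, which forces e = 0.
  U-zero : ∀ k e → ¬ e ≡ 0# → ¬ U (suc k) 0 e
  U-zero k e e≢0 (a , [] , v , d) = e≢0 (trans (at (∣⇒≈ a d) 0)
    (at (≈-trans (⊗-congˡ (monic a) (Below-0 Below-quot)) (⊗-zeroʳ (monic a))) 0))
    where
    Below-quot : Below 0 (quot a [ e ])
    Below-quot = Below-cancel (Monic-monic a) (Below-mono (s≤s z≤n) (Below-resp (∣⇒≈ a d) (Below-length [ e ])))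

  -- Cardinalities of the solution sets.

  enumerates-elements : Enumerates elements
  enumerates-elements = enumerates elements-unique elements-complete

  Vec-suc↔× : ∀ {k} → Vec Carrier (suc k) ↔ (Carrier × Vec Carrier k)
  Vec-suc↔× = mk↔ₛ′ (λ v → Vec.head v , Vec.tail v) (λ (a , v) → a ∷ v) (λ _ → refl) (λ { (a ∷ v) → refl })

  card-Carrier : Carrier ↔ Fin card
  card-Carrier = card-list elements-unique elements-complete

  card-Vec : ∀ k → Vec Carrier k ↔ Fin (card ^ k)
  card-Vec zero    = card-singleton [] λ { [] [] → refl }
  card-Vec (suc k) = ↔-trans Vec-suc↔× (card-× card-Carrier (card-Vec k))

  -- This is q - 1, introduced as a count so that the arithmetic stays free of subtraction.
  #units : ℕ
  #units = sum (map (λ u → indicator (¬? (u ≟ 0#))) elements)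

  card-Units : Units ↔ Fin #units
  card-Units = card-Σ {xs = elements} enumerates-elements _ (λ u → card-True (¬? (u ≟ 0#)))

  card≡1+#units : card ≡ suc #units
  card≡1+#units = card-unique card-Carrier (↔-trans Carrier↔⊤⊎Units (card-⊎ (card-singleton tt λ _ _ → refl) card-Units))
    where
    to : ∀ u → Dec (u ≡ 0#) → ⊤ ⊎ Units
    to u (yes _) = inj₁ tt
    to u (no nz) = inj₂ (u , fromWitness nz)
    from : ⊤ ⊎ Units → Carrier
    from (inj₁ _)       = 0#
    from (inj₂ (u , _)) = u
    from-to : ∀ u d → from (to u d) ≡ u
    from-to u (yes z) = sym z
    from-to u (no nz) = refl
    to-from : ∀ x d → to (from x) d ≡ x
    to-from (inj₁ _)       (yes _) = refl
    to-from (inj₁ _)       (no nz) = ⊥-elim (nz refl)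
    to-from (inj₂ (u , n)) (yes z) = ⊥-elim (toWitness n z)
    to-from (inj₂ (u , n)) (no nz) = cong (λ x → inj₂ (u , x)) (T-irrelevant _ n)
    Carrier↔⊤⊎Units : Carrier ↔ (⊤ ⊎ Units)
    Carrier↔⊤⊎Units = mk↔ₛ′ (λ u → to u (u ≟ 0#)) from (λ x → to-from x (from x ≟ 0#)) (λ u → from-to u (u ≟ 0#))

  card-W : ∀ k i {n} d → k ℕ.+ i ≡ d → ∀ e → U k k e ↔ Fin n → W k d e ↔ Fin (card ^ i ℕ.* n)
  card-W k i d refl e c = ↔-trans (W↔U k i e) (card-× (card-Vec i) c)

  -‿nonzero : ∀ {e} → ¬ e ≡ 0# → ¬ - e ≡ 0#
  -‿nonzero {e} e≢0 z = e≢0 (trans (sym (+-identityʳ e)) (trans (cong (e +_) (sym z)) (-‿inverseʳ e)))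

  -- The only modulus of degree 0 is 1, which divides everything, so e is arbitrary.
  card-U-0 : ∀ e → U 0 0 e ↔ Fin 1
  card-U-0 e = card-singleton ([] , [] , [] , divides refl) λ { ([] , [] , [] , divides refl) ([] , [] , [] , divides refl) → refl }

  -- Induction on the degree bound of r. Either r has smaller degree, or it is a unit times a monic
  -- polynomial of degree i < k. In the second case the flip makes r the modulus, and reducing a
  -- modulo r gives the problem `U i i` with -e, a smaller instance.
  card-U : ∀ i k → i < k → ∀ e → ¬ e ≡ 0# → U k (suc i) e ↔ Fin (#units ℕ.* card ^ (k ℕ.+ i))
  -- For r = 0 there is no solution; for r a unit the flip leads to the modulus 1.
  card-U zero (suc k) _ e e≢0 = subst (λ n → U (suc k) 1 e ↔ Fin n) arith
    (↔-trans (U-suc (suc k) 0 e) (card-⊎ (card-⊥ (U-zero k e e≢0)) (card-× card-Units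
      (↔-trans (W-flip (suc k) 0 (s≤s z≤n) (-‿inverseʳ e)) (card-W 0 (suc k) (suc k) refl (- e) (card-U-0 (- e)))))))
    where
    arith : 0 ℕ.+ #units ℕ.* (card ^ suc k ℕ.* 1) ≡ #units ℕ.* card ^ (suc k ℕ.+ 0)
    arith = cong (#units ℕ.*_) (trans (ℕₚ.*-identityʳ _) (cong (card ^_) (sym (ℕₚ.+-identityʳ (suc k)))))
  card-U (suc i) k i<k e e≢0 with ℕₚ.m≤n⇒∃[o]m+o≡n (ℕₚ.<⇒≤ i<k)
  ... | d , refl = subst (λ n → U k (suc (suc i)) e ↔ Fin n) arith
    (↔-trans (U-suc k (suc i) e) (card-⊎ (card-U i k (s≤s (ℕₚ.m≤m+n i d)) e e≢0) (card-× card-Units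
      (↔-trans (W-flip k (suc i) (s≤s z≤n) (-‿inverseʳ e))
        (card-W (suc i) d k refl (- e) (card-U i (suc i) ℕₚ.≤-refl (- e) (-‿nonzero e≢0)))))))
    where
    open ≡-Reasoning
    m = #units
    q = card
    -- As k = i + 1 + d, the second summand is m times the first, and 1 + m = q raises the exponent
    -- by one.
    arith : m ℕ.* q ^ (k ℕ.+ i) ℕ.+ m ℕ.* (q ^ d ℕ.* (m ℕ.* q ^ (suc i ℕ.+ i))) ≡ m ℕ.* q ^ (k ℕ.+ suc i)
    arith = begin
      m ℕ.* q ^ (k ℕ.+ i) ℕ.+ m ℕ.* (q ^ d ℕ.* (m ℕ.* q ^ (suc i ℕ.+ i)))
        ≡⟨ cong (λ x → m ℕ.* x ℕ.+ m ℕ.* (q ^ d ℕ.* (m ℕ.* q ^ (suc i ℕ.+ i)))) (trans (cong (q ^_) k+i≡) (ℕₚ.^-distribˡ-+-* q d (suc i ℕ.+ i))) ⟩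
      m ℕ.* (q ^ d ℕ.* q ^ (suc i ℕ.+ i)) ℕ.+ m ℕ.* (q ^ d ℕ.* (m ℕ.* q ^ (suc i ℕ.+ i)))
        ≡⟨ ℕS.solve 3 (λ m x y → m ℕS.:* (x ℕS.:* y) ℕS.:+ m ℕS.:* (x ℕS.:* (m ℕS.:* y)) ℕS.:= m ℕS.:* ((ℕS.con 1 ℕS.:+ m) ℕS.:* (x ℕS.:* y))) refl m (q ^ d) (q ^ (suc i ℕ.+ i)) ⟩
      m ℕ.* (suc m ℕ.* (q ^ d ℕ.* q ^ (suc i ℕ.+ i)))
        ≡⟨ cong (λ x → m ℕ.* (suc m ℕ.* x)) (trans (cong (q ^_) k+i≡) (ℕₚ.^-distribˡ-+-* q d (suc i ℕ.+ i))) ⟨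
      m ℕ.* (suc m ℕ.* q ^ (k ℕ.+ i))
        ≡⟨ cong (λ x → m ℕ.* (x ℕ.* q ^ (k ℕ.+ i))) card≡1+#units ⟨
      m ℕ.* q ^ suc (k ℕ.+ i)
        ≡⟨ cong (λ x → m ℕ.* q ^ x) (ℕₚ.+-suc k i) ⟨
      m ℕ.* q ^ (k ℕ.+ suc i) ∎
      where
      k+i≡ : k ℕ.+ i ≡ d ℕ.+ (suc i ℕ.+ i)
      k+i≡ = ℕS.solve 2 (λ i d → ℕS.con 1 ℕS.:+ i ℕS.:+ d ℕS.:+ i ℕS.:= d ℕS.:+ (ℕS.con 1 ℕS.:+ i ℕS.:+ i)) refl i d

  -- The number of solutions in terms of the least degree, of which only the vanishing matters.
  weight : ℕ → ℕ → ℕ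
  weight zero    n = card ^ n
  weight (suc k) n = #units ℕ.* card ^ (n ℕ.∸ 1)

  -- With k least, both factors can be divided by a: `Y↔W` reduces the second and `W↔U` the first,
  -- each leaving a free monic quotient.
  card-Y : ∀ k l l′ → k ≤ l → k ≤ l′ → ∀ e → ¬ e ≡ 0# → Y k l l′ e ↔ Fin (weight k (l ℕ.+ l′))
  card-Y k l l′ k≤l k≤l′ e e≢0 with ℕₚ.m≤n⇒∃[o]m+o≡n k≤l | ℕₚ.m≤n⇒∃[o]m+o≡n k≤l′
  card-Y zero l l′ k≤l k≤l′ e e≢0 | i , refl | j , refl =
    subst (λ n → Y 0 l l′ e ↔ Fin n) arith
    (↔-trans (Y↔W 0 i j e) (card-× (card-Vec j) (card-W 0 i i refl e (card-U-0 e))))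
    where
    arith : card ^ j ℕ.* (card ^ i ℕ.* 1) ≡ card ^ (i ℕ.+ j)
    arith = trans (cong (card ^ j ℕ.*_) (ℕₚ.*-identityʳ (card ^ i))) (trans (ℕₚ.*-comm (card ^ j) (card ^ i)) (sym (ℕₚ.^-distribˡ-+-* card i j)))
  card-Y (suc k) l l′ k≤l k≤l′ e e≢0 | i , refl | j , refl =
    subst (λ n → Y (suc k) l l′ e ↔ Fin n) arith
    (↔-trans (Y↔W (suc k) l j e) (card-× (card-Vec j) (card-W (suc k) i l refl e (card-U k (suc k) ℕₚ.≤-refl e e≢0))))
    where
    open ≡-Reasoning
    m = #units
    q = card
    -- The exponent on the right is l + l′ - 1 with l = k + 1 + i and l′ = k + 1 + j, as the
    -- truncated subtraction in `weight` computes it.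
    arith : q ^ j ℕ.* (q ^ i ℕ.* (m ℕ.* q ^ (suc k ℕ.+ k))) ≡ m ℕ.* q ^ (k ℕ.+ i ℕ.+ (suc k ℕ.+ j))
    arith = begin
      q ^ j ℕ.* (q ^ i ℕ.* (m ℕ.* q ^ (suc k ℕ.+ k)))
        ≡⟨ ℕS.solve 4 (λ x y m z → x ℕS.:* (y ℕS.:* (m ℕS.:* z)) ℕS.:= m ℕS.:* (x ℕS.:* (y ℕS.:* z))) refl (q ^ j) (q ^ i) m (q ^ (suc k ℕ.+ k)) ⟩
      m ℕ.* (q ^ j ℕ.* (q ^ i ℕ.* q ^ (suc k ℕ.+ k)))
        ≡⟨ cong (λ x → m ℕ.* (q ^ j ℕ.* x)) (ℕₚ.^-distribˡ-+-* q i (suc k ℕ.+ k)) ⟨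
      m ℕ.* (q ^ j ℕ.* q ^ (i ℕ.+ (suc k ℕ.+ k)))
        ≡⟨ cong (m ℕ.*_) (ℕₚ.^-distribˡ-+-* q j _) ⟨
      m ℕ.* q ^ (j ℕ.+ (i ℕ.+ (suc k ℕ.+ k)))
        ≡⟨ cong (λ x → m ℕ.* q ^ x) (ℕS.solve 3 (λ i j k → j ℕS.:+ (i ℕS.:+ (ℕS.con 1 ℕS.:+ k ℕS.:+ k)) ℕS.:= k ℕS.:+ i ℕS.:+ (ℕS.con 1 ℕS.:+ k ℕS.:+ j)) refl i j k) ⟩
      m ℕ.* q ^ (k ℕ.+ i ℕ.+ (suc k ℕ.+ j)) ∎

-- The equation b b′ = a a′ + e for prescribed degrees.

module Shifted (F : FiniteField) where
  open Congruences F public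
  open import Data.Nat using (_^_)

  -- Solutions of b b′ = a a′ + e in monic polynomials of degrees k, k′, l, l′;
  -- both sides are monic of degree n, so comparing their n lower coefficients suffices.
  T : (n : ℕ) → Carrier → (k k′ l l′ : ℕ) → Set
  T n e k k′ l l′ = Σ (Vec Carrier k) λ a → Σ (Vec Carrier k′) λ a′ → Σ (Vec Carrier l) λ b → Σ (Vec Carrier l′) λ b′ →
    vec n (monic b ⊗ monic b′) ≡ vec n (monic a ⊗ monic a′ ⊕ [ e ])

  Monic-product : ∀ {k k′ n} → k ℕ.+ k′ ≡ n → (a : Vec Carrier k) (a′ : Vec Carrier k′) → Monic n (monic a ⊗ monic a′)
  Monic-product refl a a′ = Monic-⊗ (Monic-monic a) (Monic-monic a′)

  Monic-+const : ∀ {n p} → 1 ≤ n → Monic n p → ∀ e → Monic n (p ⊕ [ e ])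
  Monic-+const 1≤n m e = Monic-⊕ m (Below-mono 1≤n (Below-length [ e ]))

  module _ {n : ℕ} (1≤n : 1 ≤ n) {e d : Carrier} (e+d≡0 : e + d ≡ 0#) where

    d+e≡0 : d + e ≡ 0#
    d+e≡0 = trans (+-comm d e) e+d≡0

    vec-move : ∀ {p q} → Monic n p → Monic n q → vec n q ≡ vec n (p ⊕ [ e ]) → q ⊕ [ d ] ≈ p
    vec-move {p} {q} mp mq h = ≈-trans (⊕-cong (vec-injective-Monic mq (Monic-+const 1≤n mp e) h) (≈-refl {[ d ]}))
      (cancel-const p e+d≡0)

    -- The cofactor a′ can only be the quotient of p + d by a, with d = -e, so its existence is a
    -- proposition equivalent to divisibility.
    cofactor↔∣ : ∀ {k k′} → k ℕ.+ k′ ≡ n → (a : Vec Carrier k) → ∀ {p} → Monic n p →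
                 (Σ (Vec Carrier k′) λ a′ → vec n p ≡ vec n (monic a ⊗ monic a′ ⊕ [ e ])) ↔ (a ∣ p ⊕ [ d ])
    cofactor↔∣ {k} {k′} refl a {p} mp = proposition↔ irr (∣-irrelevant a) (λ (a′ , h) → ≈⇒∣ a (monic a′) (move a′ h)) from
      where
      move : ∀ a′ → vec n p ≡ vec n (monic a ⊗ monic a′ ⊕ [ e ]) → p ⊕ [ d ] ≈ monic a ⊗ monic a′
      move a′ = vec-move (Monic-product refl a a′) mp
      irr : Irrelevant (Σ (Vec Carrier k′) λ a′ → vec n p ≡ vec n (monic a ⊗ monic a′ ⊕ [ e ]))
      irr (a′ , h) (a″ , h′) = Σ-≡ (λ _ → ≡-irrelevant) (monic-injective
        (≈-trans (≈-sym (quot-unique a (monic a′) (move a′ h))) (quot-unique a (monic a″) (move a″ h′))))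
      from : a ∣ p ⊕ [ d ] → Σ (Vec Carrier k′) λ a′ → vec n p ≡ vec n (monic a ⊗ monic a′ ⊕ [ e ])
      from a∣ = vec k′ s , vec-cong n (≈-sym (≈-trans (⊕-cong (≈-trans (⊗-congˡ (monic a) (monic-vec ms)) (≈-sym p+d≈)) (≈-refl {[ e ]}))
                                                      (cancel-const p d+e≡0)))
        where
        s = quot a (p ⊕ [ d ])
        p+d≈ : p ⊕ [ d ] ≈ monic a ⊗ s
        p+d≈ = ∣⇒≈ a a∣
        ms : Monic k′ s
        ms = Monic-cancel (Monic-monic a) (Monic-resp p+d≈ (Monic-+const 1≤n mp d))

    T↔Y : ∀ {k k′ l l′} → k ℕ.+ k′ ≡ n → l ℕ.+ l′ ≡ n → T n e k k′ l l′ ↔ Y k l l′ d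
    T↔Y hk hl = Σ-cong λ a → ↔-trans Σ-swap (Σ-cong λ b → ↔-trans Σ-swap (Σ-cong λ b′ →
      cofactor↔∣ hk a (Monic-product hl b b′)))

    -- Moving the constant across turns b b′ = a a′ + e into a a′ = b b′ + d with d = -e.
    T-flip : ∀ {k k′ l l′} → k ℕ.+ k′ ≡ n → l ℕ.+ l′ ≡ n → T n e k k′ l l′ ↔ T n d l l′ k k′
    T-flip hk hl = ↔-trans
      (Σ-cong λ a → Σ-cong λ a′ → Σ-cong λ b → Σ-cong λ b′ → proposition↔ ≡-irrelevant ≡-irrelevant
        (λ h → vec-cong n (≈-sym (vec-move (Monic-product hk a a′) (Monic-product hl b b′) h)))
        (λ h → vec-cong n (≈-sym (≈-trans
          (⊕-cong (vec-injective-Monic (Monic-product hk a a′) (Monic-+const 1≤n (Monic-product hl b b′) d) h) (≈-refl {[ e ]}))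
          (cancel-const (monic b ⊗ monic b′) d+e≡0)))))
      (mk↔ₛ′ (λ (a , a′ , b , b′ , h) → b , b′ , a , a′ , h) (λ (b , b′ , a , a′ , h) → a , a′ , b , b′ , h)
             (λ _ → refl) (λ _ → refl))

  T-swapˡ : ∀ {n e k k′ l l′} → T n e k k′ l l′ ↔ T n e k′ k l l′
  T-swapˡ {n} {e} = ↔-trans Σ-swap (Σ-cong λ a′ → Σ-cong λ a → Σ-cong λ b → Σ-cong λ b′ →
    proposition↔ ≡-irrelevant ≡-irrelevant (λ h → trans h (swap≡ a a′)) (λ h → trans h (swap≡ a′ a)))
    where
    swap≡ : ∀ {k k′} (a : Vec Carrier k) (a′ : Vec Carrier k′) → vec n (monic a ⊗ monic a′ ⊕ [ e ]) ≡ vec n (monic a′ ⊗ monic a ⊕ [ e ])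
    swap≡ a a′ = vec-cong n (⊕-cong (⊗-comm (monic a) (monic a′)) (≈-refl {[ e ]}))

  T-swapʳ : ∀ {n e k k′ l l′} → T n e k k′ l l′ ↔ T n e k k′ l′ l
  T-swapʳ {n} = Σ-cong λ a → Σ-cong λ a′ → ↔-trans Σ-swap (Σ-cong λ b′ → Σ-cong λ b →
    proposition↔ ≡-irrelevant ≡-irrelevant
      (λ h → trans (vec-cong n (⊗-comm (monic b′) (monic b))) h) (λ h → trans (vec-cong n (⊗-comm (monic b) (monic b′))) h))

  -- `weight` sees only whether its first argument vanishes, and the least of four degrees is
  -- positive exactly when all four are.
  weight-δ : ∀ {k k′ l l′} n → k ≤ k′ → k ≤ l → k ≤ l′ → weight k n ≡ weight (δ k k′ ℕ.* δ l l′) n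
  weight-δ {zero}  n z≤n     z≤n     z≤n     = refl
  weight-δ {suc k} n (s≤s _) (s≤s _) (s≤s _) = refl

  card-T-least : ∀ {n e k k′ l l′} → 1 ≤ n → ¬ e ≡ 0# → k ℕ.+ k′ ≡ n → l ℕ.+ l′ ≡ n → k ≤ l → k ≤ l′ →
                 T n e k k′ l l′ ↔ Fin (weight (δ k k′ ℕ.* δ l l′) n)
  card-T-least {n} {e} {k} {k′} {l} {l′} 1≤n e≢0 hk refl k≤l k≤l′ =
    subst (λ w → T n e k k′ l l′ ↔ Fin w) (weight-δ n k≤k′ k≤l k≤l′)
      (↔-trans (T↔Y 1≤n (-‿inverseʳ e) hk refl) (card-Y k l l′ k≤l k≤l′ (- e) (-‿nonzero e≢0)))
    where
    k≤k′ : k ≤ k′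
    -- Otherwise k′ < k ≤ l′ and k ≤ l, making k + k′ smaller than l + l′, while both equal n.
    k≤k′ = ℕₚ.≮⇒≥ λ k′<k → ℕₚ.<-irrefl hk (ℕₚ.+-mono-≤-< k≤l (ℕₚ.<-≤-trans k′<k k≤l′))

  -- With both pairs sorted, the least degree is k or l; exchanging the sides brings it to the
  -- front. This changes the sign of e, which is why the count is made for every nonzero e and not
  -- only for 1.
  card-T-ordered : ∀ {n e k k′ l l′} → 1 ≤ n → ¬ e ≡ 0# → k ℕ.+ k′ ≡ n → l ℕ.+ l′ ≡ n → k ≤ k′ → l ≤ l′ →
                   T n e k k′ l l′ ↔ Fin (weight (δ k k′ ℕ.* δ l l′) n)
  card-T-ordered {n} {e} {k} {k′} {l} {l′} 1≤n e≢0 hk hl k≤k′ l≤l′ with ℕₚ.≤-total k l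
  ... | inj₁ k≤l = card-T-least 1≤n e≢0 hk hl k≤l (ℕₚ.≤-trans k≤l l≤l′)
  ... | inj₂ l≤k = subst (λ x → T n e k k′ l l′ ↔ Fin (weight x n)) (ℕₚ.*-comm (δ l l′) (δ k k′))
    (↔-trans (T-flip 1≤n (-‿inverseʳ e) hk hl)
      (card-T-least 1≤n (-‿nonzero e≢0) hl hk l≤k (ℕₚ.≤-trans l≤k k≤k′)))

  card-T-orderedˡ : ∀ {n e k k′ l l′} → 1 ≤ n → ¬ e ≡ 0# → k ℕ.+ k′ ≡ n → l ℕ.+ l′ ≡ n → k ≤ k′ →
                    T n e k k′ l l′ ↔ Fin (weight (δ k k′ ℕ.* δ l l′) n)
  card-T-orderedˡ {n} {e} {k} {k′} {l} {l′} 1≤n e≢0 hk hl k≤k′ with ℕₚ.≤-total l l′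
  ... | inj₁ l≤l′ = card-T-ordered 1≤n e≢0 hk hl k≤k′ l≤l′
  ... | inj₂ l′≤l = subst (λ x → T n e k k′ l l′ ↔ Fin (weight (δ k k′ ℕ.* x) n)) (ℕₚ.*-comm (sgn l′) (sgn l))
    (↔-trans T-swapʳ (card-T-ordered 1≤n e≢0 hk (trans (ℕₚ.+-comm l′ l) hl) k≤k′ l′≤l))

  -- Exchanging the factors on each side sorts both pairs, and `δ` is symmetric.
  card-T : ∀ {n e k k′ l l′} → 1 ≤ n → ¬ e ≡ 0# → k ℕ.+ k′ ≡ n → l ℕ.+ l′ ≡ n →
           T n e k k′ l l′ ↔ Fin (weight (δ k k′ ℕ.* δ l l′) n)
  card-T {n} {e} {k} {k′} {l} {l′} 1≤n e≢0 hk hl with ℕₚ.≤-total k k′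
  ... | inj₁ k≤k′ = card-T-orderedˡ 1≤n e≢0 hk hl k≤k′
  ... | inj₂ k′≤k = subst (λ x → T n e k k′ l l′ ↔ Fin (weight (x ℕ.* δ l l′) n)) (ℕₚ.*-comm (sgn k′) (sgn k))
    (↔-trans T-swapˡ (card-T-orderedˡ 1≤n e≢0 (trans (ℕₚ.+-comm k′ k) hk) hl k′≤k))

  -- The sum `S` as a count of solutions.

  Σ-Vec-zero : {P : Vec Carrier 0 → Set} → Σ (Vec Carrier 0) P ↔ (P [] ⊎ ⊥)
  Σ-Vec-zero = mk↔ₛ′ (λ { ([] , x) → inj₁ x }) (λ { (inj₁ x) → [] , x }) (λ { (inj₁ x) → refl }) (λ { ([] , x) → refl })

  Σ-Vec-suc : ∀ {k} {P : Vec Carrier (suc k) → Set} →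
              Σ (Vec Carrier (suc k)) P ↔ (Σ Carrier λ a → Σ (Vec Carrier k) λ v → P (a ∷ v))
  Σ-Vec-suc {k} {P} = mk↔ₛ′ to from (λ _ → refl) (λ { (a ∷ v , x) → refl })
    where
    to : Σ (Vec Carrier (suc k)) P → (Σ Carrier λ a → Σ (Vec Carrier k) λ v → P (a ∷ v))
    to (a ∷ v , x) = a , v , x
    from : (Σ Carrier λ a → Σ (Vec Carrier k) λ v → P (a ∷ v)) → Σ (Vec Carrier (suc k)) P
    from (a , v , x) = a ∷ v , x

  enumerates-allVecs : ∀ k → Enumerates (allVecs k)
  enumerates-allVecs zero    g = ↔-trans Σ-Vec-zero (card-⊎ ↔-refl (↔-sym 0↔⊥))
  enumerates-allVecs (suc k) g = subst (λ n → Σ (Vec Carrier (suc k)) (Fin ∘ g) ↔ Fin n)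
    (sym (trans (sum-map-concatMap g (λ a → map (a ∷_) (allVecs k)) elements)
                (cong sum (map-cong (λ a → cong sum (sym (map-∘ (allVecs k)))) elements))))
    (↔-trans Σ-Vec-suc
      (card-Σ {xs = elements} enumerates-elements _ (λ a → enumerates-allVecs k (λ v → g (a ∷ v)))))

  card-Σ-𝓜 : ∀ k (g : Pol → ℕ) → Σ (Vec Carrier k) (Fin ∘ g ∘ monic) ↔ Fin (sum (map g (𝓜 k)))
  card-Σ-𝓜 k g = subst (λ xs → Σ (Vec Carrier k) (Fin ∘ g ∘ monic) ↔ Fin (sum xs)) (map-∘ (allVecs k)) (enumerates-allVecs k (g ∘ monic))

  Factorisations : Pol → ℕ → ℕ → Set
  Factorisations f k k′ = Σ (Vec Carrier k) λ a → Σ (Vec Carrier k′) λ a′ → True (mulP (monic a) (monic a′) ≟P f)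

  card-Factorisations : ∀ f k → Factorisations f k (deg f ∸ k) ↔ Fin (length (pairsWithProduct f k))
  card-Factorisations f k = subst (λ n → Factorisations f k (deg f ∸ k) ↔ Fin n)
    (sym (trans (length-filter _ (cartesianProduct (𝓜 k) (𝓜 (deg f ∸ k)))) (sum-map-cartesianProduct _ (𝓜 k) (𝓜 (deg f ∸ k)))))
    (↔-trans (Σ-cong λ a → ↔-trans (Σ-cong λ a′ → card-True (mulP (monic a) (monic a′) ≟P f))
                                    (card-Σ-𝓜 (deg f ∸ k) (λ p → indicator (mulP (monic a) p ≟P f))))
             (card-Σ-𝓜 k _))

  card-d₂ : ∀ f n → deg f ≡ n → (Σ (Fin (suc n)) λ k → Factorisations f (toℕ k) (n ∸ toℕ k)) ↔ Fin (d₂ f)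
  card-d₂ f n refl = ↔-trans (Σ-cong λ k → card-Factorisations f (toℕ k)) (card-Σ-Fin (suc n) (λ k → length (pairsWithProduct f k)))

  -- `d₂` compares coefficient lists; for lists of equal length this agrees with equality up to
  -- trailing zeros.
  ≈⇒Pointwise : ∀ p q → length p ≡ length q → p ≈ q → Pointwise _≡_ p q
  ≈⇒Pointwise []      []      _ _ = []
  ≈⇒Pointwise (a ∷ p) (b ∷ q) l e = at e 0 ∷ ≈⇒Pointwise p q (ℕₚ.suc-injective l) (mk≈ λ i → at e (suc i))

  Pointwise⇒≈ : ∀ {p q} → Pointwise _≡_ p q → p ≈ q
  Pointwise⇒≈ []      = ≈-refl
  Pointwise⇒≈ (e ∷ h) = ∷-cong e (Pointwise⇒≈ h)

  length-⊕ : ∀ p q → length (p ⊕ q) ≡ length p ⊔ length q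
  length-⊕ []      q       = refl
  length-⊕ (a ∷ p) []      = refl
  length-⊕ (a ∷ p) (b ∷ q) = cong suc (length-⊕ p q)

  length-⊗ : ∀ a p b q → length ((a ∷ p) ⊗ (b ∷ q)) ≡ length p ℕ.+ suc (length q)
  length-⊗ a []       b q = cong suc (trans (length-⊕ (scale a q) []) (trans (ℕₚ.⊔-identityʳ _) (length-map _ q)))
  length-⊗ a (a′ ∷ p) b q = cong suc (begin
    length (scale a q ⊕ M)          ≡⟨ length-⊕ (scale a q) M ⟩
    length (scale a q) ⊔ length M   ≡⟨ cong₂ _⊔_ (length-map _ q) (length-⊗ a′ p b q) ⟩
    length q ⊔ (length p ℕ.+ suc (length q))  ≡⟨ ℕₚ.m≤n⇒m⊔n≡n (ℕₚ.≤-trans (ℕₚ.n≤1+n _) (ℕₚ.m≤n+m _ (length p))) ⟩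
    length p ℕ.+ suc (length q)     ∎)
    where
    open ≡-Reasoning
    M = (a′ ∷ p) ⊗ (b ∷ q)

  length-monic : ∀ {k} (v : Vec Carrier k) → length (monic v) ≡ suc k
  length-monic []      = refl
  length-monic (a ∷ v) = cong suc (length-monic v)

  length-monic⊗monic : ∀ {k k′ n} → k ℕ.+ k′ ≡ n → (a : Vec Carrier k) (a′ : Vec Carrier k′) → length (monic a ⊗ monic a′) ≡ suc n
  length-monic⊗monic {k} {k′} refl a a′ with monic a | length-monic a | monic a′ | length-monic a′
  ... | x ∷ p | h | y ∷ q | h′ = trans (length-⊗ x p y q) (trans (cong₂ (λ i j → i ℕ.+ j) (ℕₚ.suc-injective h) h′) (ℕₚ.+-suc k k′))

  length-plusOne : ∀ {n} → 1 ≤ n → (v : Vec Carrier n) → length (plusOne (monic v)) ≡ suc n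
  length-plusOne {n} 1≤n v = trans (length-⊕ (monic v) [ 1# ]) (trans (cong (_⊔ 1) (length-monic v)) (ℕₚ.m≥n⇒m⊔n≡m (s≤s z≤n)))

  True↔vec≡ : ∀ {n p q} → length p ≡ suc n → length q ≡ suc n → Monic n p → Monic n q → True (p ≟P q) ↔ (vec n p ≡ vec n q)
  True↔vec≡ {n} {p} {q} lp lq mp mq = proposition↔ T-irrelevant ≡-irrelevant
    (λ t → vec-cong n (Pointwise⇒≈ (toWitness t)))
    (λ h → fromWitness (≈⇒Pointwise p q (trans lp (sym lq)) (vec-injective-Monic mp mq h)))

  degrees : ∀ {n} (k : Fin (suc n)) → toℕ k ℕ.+ (n ∸ toℕ k) ≡ n
  degrees k = ℕₚ.m+[n∸m]≡n (ℕₚ.≤-pred (toℕ<n k))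

  -- A term of `S` is f with a factorisation a a′ of f and a factorisation b b′ of f + 1. The first
  -- determines f, which `Σ-singleton` eliminates, leaving b b′ = a a′ + 1.
  S-as-T : ∀ n → 1 ≤ n → (Σ (Fin (suc n)) λ k → Σ (Fin (suc n)) λ l → T n 1# (toℕ k) (n ∸ toℕ k) (toℕ l) (n ∸ toℕ l)) ↔ Fin (S n)
  S-as-T n 1≤n = ↔-sym (↔-trans (↔-sym (card-Σ-𝓜 n (λ f → d₂ f ℕ.* d₂ (plusOne f))))
    (↔-trans (Σ-cong λ v → ↔-trans (↔-sym (card-×
        (card-d₂ (monic v) n (cong (_∸ 1) (length-monic v)))
        (card-d₂ (plusOne (monic v)) n (cong (_∸ 1) (length-plusOne 1≤n v)))))
      ((Σ-cong λ k → Σ-cong λ a → Σ-cong λ a′ → factor↔ k a a′ v) ×-↔ (Σ-cong λ l → Σ-cong λ b → Σ-cong λ b′ → factor+1↔ l b b′ v)))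
    (↔-trans regroup
      (Σ-cong λ k → Σ-cong λ l → Σ-cong λ a → Σ-cong λ a′ → Σ-cong λ b → Σ-cong λ b′ →
        ↔-trans (Σ-singleton (vec n (monic a ⊗ monic a′))) (eliminate k a a′)))))
    where
    factor↔ : ∀ k (a : Vec Carrier (toℕ k)) (a′ : Vec Carrier (n ∸ toℕ k)) (v : Vec Carrier n) →
              True (mulP (monic a) (monic a′) ≟P monic v) ↔ (v ≡ vec n (monic a ⊗ monic a′))
    factor↔ k a a′ v = ↔-trans
      (True↔vec≡ (length-monic⊗monic (degrees k) a a′) (length-monic v) (Monic-product (degrees k) a a′) (Monic-monic v))
      (proposition↔ ≡-irrelevant ≡-irrelevant (λ h → sym (trans h (vec-monic v))) (λ h → trans (sym h) (sym (vec-monic v))))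

    factor+1↔ : ∀ l (b : Vec Carrier (toℕ l)) (b′ : Vec Carrier (n ∸ toℕ l)) (v : Vec Carrier n) →
                True (mulP (monic b) (monic b′) ≟P plusOne (monic v)) ↔ (vec n (monic b ⊗ monic b′) ≡ vec n (monic v ⊕ [ 1# ]))
    factor+1↔ l b b′ v = True↔vec≡ (length-monic⊗monic (degrees l) b b′) (length-plusOne 1≤n v)
      (Monic-product (degrees l) b b′) (Monic-+const 1≤n (Monic-monic v) 1#)

    eliminate : ∀ k (a : Vec Carrier (toℕ k)) (a′ : Vec Carrier (n ∸ toℕ k)) {x : Vec Carrier n} →
                (x ≡ vec n (monic (vec n (monic a ⊗ monic a′)) ⊕ [ 1# ])) ↔ (x ≡ vec n (monic a ⊗ monic a′ ⊕ [ 1# ]))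
    eliminate k a a′ = proposition↔ ≡-irrelevant ≡-irrelevant (λ h → trans h e) (λ h → trans h (sym e))
      where
      e : vec n (monic (vec n (monic a ⊗ monic a′)) ⊕ [ 1# ]) ≡ vec n (monic a ⊗ monic a′ ⊕ [ 1# ])
      e = vec-cong n (⊕-cong (monic-vec (Monic-product (degrees k) a a′)) (≈-refl {[ 1# ]}))

    regroup : {V K : Set} {A A′ : K → Set} {P : V → ∀ k → A k → A′ k → Set} {Q : V → ∀ l → A l → A′ l → Set} →
      (Σ V λ v → (Σ K λ k → Σ (A k) λ a → Σ (A′ k) λ a′ → P v k a a′) × (Σ K λ l → Σ (A l) λ b → Σ (A′ l) λ b′ → Q v l b b′)) ↔
      (Σ K λ k → Σ K λ l → Σ (A k) λ a → Σ (A′ k) λ a′ → Σ (A l) λ b → Σ (A′ l) λ b′ → Σ V λ v → P v k a a′ × Q v l b b′)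
    regroup = mk↔ₛ′ (λ (v , (k , a , a′ , p) , (l , b , b′ , q)) → k , l , a , a′ , b , b′ , v , p , q)
                    (λ (k , l , a , a′ , b , b′ , v , p , q) → v , (k , a , a′ , p) , (l , b , b′ , q))
                    (λ _ → refl) (λ _ → refl)

  S-as-sum : ∀ n → 1 ≤ n → S n ≡ sum (map (λ k → sum (map (λ l → weight (δ k (n ∸ k) ℕ.* δ l (n ∸ l)) n) (upTo (suc n)))) (upTo (suc n)))
  S-as-sum n 1≤n = card-unique (S-as-T n 1≤n)
    (↔-trans (Σ-cong λ k → ↔-trans (Σ-cong λ l → card-T 1≤n 1≢0 (degrees k) (degrees l)) (card-Σ-Fin (suc n) (λ l → weight (δ (toℕ k) (n ∸ toℕ k) ℕ.* δ l (n ∸ l)) n)))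
      (card-Σ-Fin (suc n) (λ k → sum (map (λ l → weight (δ k (n ∸ k) ℕ.* δ l (n ∸ l)) n) (upTo (suc n))))))

  -- With n = m + 1 this says that the weight is q^n - q^(n-1) `sgn x`, multiplied by q and without
  -- subtraction.
  weight-complement : ∀ m x → card ℕ.* weight x (suc m) ℕ.+ card ^ suc m ℕ.* sgn x ≡ card ^ suc m ℕ.* card
  weight-complement m zero    = trans (cong (card ℕ.* card ^ suc m ℕ.+_) (ℕₚ.*-zeroʳ (card ^ suc m)))
    (trans (ℕₚ.+-identityʳ _) (ℕₚ.*-comm card (card ^ suc m)))
  weight-complement m (suc x) = begin
    card ℕ.* (#units ℕ.* card ^ m) ℕ.+ card ℕ.* card ^ m ℕ.* 1
      ≡⟨ ℕS.solve 3 (λ q u z → q ℕS.:* (u ℕS.:* z) ℕS.:+ q ℕS.:* z ℕS.:* ℕS.con 1 ℕS.:= q ℕS.:* z ℕS.:* (ℕS.con 1 ℕS.:+ u)) refl card #units (card ^ m) ⟩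
    card ℕ.* card ^ m ℕ.* suc #units
      ≡⟨ cong (card ℕ.* card ^ m ℕ.*_) card≡1+#units ⟨
    card ℕ.* card ^ m ℕ.* card ∎
    where open ≡-Reasoning

  sgn-idem : ∀ k k′ l l′ → sgn (δ k k′ ℕ.* δ l l′) ≡ δ k k′ ℕ.* δ l l′
  sgn-idem zero    _       _       _       = refl
  sgn-idem (suc _) zero    _       _       = refl
  sgn-idem (suc _) (suc _) zero    _       = refl
  sgn-idem (suc _) (suc _) (suc _) zero    = refl
  sgn-idem (suc _) (suc _) (suc _) (suc _) = refl

  -- The theorem for n = m + 1, multiplied by q^(n+1) and with the negative term moved to the left,
  -- so that it lives in the natural numbers.
  S-formula : ∀ m → card ℕ.* S (suc m) ℕ.+ card ^ suc m ℕ.* (m ℕ.* m) ≡ (2 ℕ.+ m) ℕ.* ((2 ℕ.+ m) ℕ.* (card ^ suc m ℕ.* card))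
  S-formula m = begin
    card ℕ.* S n ℕ.+ card ^ n ℕ.* (m ℕ.* m)
      ≡⟨ cong₂ (λ x y → card ℕ.* x ℕ.+ card ^ n ℕ.* y) (S-as-sum n (s≤s z≤n)) (sym sum-δδ) ⟩
    card ℕ.* sum (map (λ k → sum (map (λ l → weight (δ k (n ∸ k) ℕ.* δ l (n ∸ l)) n) xs)) xs) ℕ.+ card ^ n ℕ.* sum (map (λ k → sum (map (λ l → Δ k ℕ.* Δ l) xs)) xs)
      ≡⟨ double-sum (λ k l → weight (Δ k ℕ.* Δ l) n) (λ k l → Δ k ℕ.* Δ l) card (card ^ n) xs
           (λ k l → trans (cong (λ x → card ℕ.* weight (Δ k ℕ.* Δ l) n ℕ.+ card ^ n ℕ.* x) (sym (sgn-idem k (n ∸ k) l (n ∸ l))))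
                          (weight-complement m (Δ k ℕ.* Δ l))) ⟩
    length xs ℕ.* (length xs ℕ.* (card ^ n ℕ.* card))
      ≡⟨ cong (λ x → x ℕ.* (x ℕ.* (card ^ n ℕ.* card))) (length-upTo (suc n)) ⟩
    (2 ℕ.+ m) ℕ.* ((2 ℕ.+ m) ℕ.* (card ^ n ℕ.* card)) ∎
    where
    open ≡-Reasoning
    n = suc m
    xs = upTo (suc n)
    Δ : ℕ → ℕ
    Δ k = δ k (n ∸ k)
    sum-δδ : sum (map (λ k → sum (map (λ l → Δ k ℕ.* Δ l) xs)) xs) ≡ m ℕ.* m
    sum-δδ = begin
      sum (map (λ k → sum (map (λ l → Δ k ℕ.* Δ l) xs)) xs)
        ≡⟨ cong sum (map-cong (λ k → trans (sum-map-* (Δ k) Δ xs) (trans (cong (Δ k ℕ.*_) (sum-δ m)) (ℕₚ.*-comm (Δ k) m))) xs) ⟩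
      sum (map (λ k → m ℕ.* Δ k) xs)
        ≡⟨ sum-map-* m Δ xs ⟩
      m ℕ.* sum (map Δ xs)
        ≡⟨ cong (m ℕ.*_) (sum-δ m) ⟩
      m ℕ.* m ∎

-- Passage to the integers.

open import Data.Integer using (ℤ; +_; _*_; _-_; _^_)

pos-^ : ∀ q n → (+ q) ^ n ≡ + (q ℕ.^ n)
pos-^ q zero    = refl
pos-^ q (suc n) = trans (cong (+ q *_) (pos-^ q n)) (sym (ℤₚ.pos-* q (q ℕ.^ n)))

theorem7p1 : (F : FiniteField) → (n : ℕ) → n Data.Nat.≥ 1 →
    let q = FiniteField.card F in
    + q * + Poly.S F n ≡ (+ q) ^ n * (+ q * (+ (n Data.Nat.+ 1)) ^ 2 - (+ n - + 1) ^ 2)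
theorem7p1 F (suc m) _ = begin
  + q * + s
    -- Adding and subtracting `c`, which is q^n (n - 1)^2, prepares for the subtraction-free
    -- `S-formula`.
    ≡⟨ ℤₚ.+-identityʳ _ ⟨
  + q * + s ℤ.+ + 0
    ≡⟨ cong (λ x → + q * + s ℤ.+ x) (ℤₚ.+-inverseʳ (+ c)) ⟨
  + q * + s ℤ.+ (+ c - + c)
    ≡⟨ ℤₚ.+-assoc (+ q * + s) (+ c) (ℤ.- + c) ⟨
  + q * + s ℤ.+ + c - + c
    ≡⟨ cong (_- + c) lhs ⟩
  + Q * (+ q * N²) - + c
    ≡⟨ cong (λ x → + Q * (+ q * N²) - x) c≡ ⟩
  + Q * (+ q * N²) - + Q * M²
    ≡⟨ cong (λ x → + Q * (+ q * N²) ℤ.+ x) (ℤₚ.neg-distribʳ-* (+ Q) M²) ⟩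
  + Q * (+ q * N²) ℤ.+ + Q * (ℤ.- M²)
    ≡⟨ ℤₚ.*-distribˡ-+ (+ Q) (+ q * N²) (ℤ.- M²) ⟨
  + Q * (+ q * N² - M²)
    ≡⟨ cong (_* (+ q * N² - M²)) (pos-^ q n) ⟨
  (+ q) ^ n * (+ q * N² - M²) ∎
  where
  open ≡-Reasoning
  n = suc m
  q = FiniteField.card F
  s = Poly.S F n
  Q = q ℕ.^ n
  c = Q ℕ.* (m ℕ.* m)
  N² = (+ (n ℕ.+ 1)) ^ 2
  M² = (+ n - + 1) ^ 2
  c≡ : + c ≡ + Q * M²
  -- With n = `suc m`, the difference `+ n - + 1` computes to `+ m`; the extra factor 1 comes from
  -- unfolding `m ^ 2`.
  c≡ = trans (cong +_ (cong (λ x → Q ℕ.* (m ℕ.* x)) (sym (ℕₚ.*-identityʳ m))))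
    (trans (ℤₚ.pos-* Q (m ℕ.* (m ℕ.* 1))) (cong (+ Q *_) (sym (pos-^ m 2))))
  lhs : + q * + s ℤ.+ + c ≡ + Q * (+ q * N²)
  lhs = begin
    + q * + s ℤ.+ + c       ≡⟨ cong (ℤ._+ + c) (ℤₚ.pos-* q s) ⟨
    + (q ℕ.* s) ℤ.+ + c     ≡⟨ ℤₚ.pos-+ (q ℕ.* s) c ⟨
    + (q ℕ.* s ℕ.+ c)       ≡⟨ cong +_ (Shifted.S-formula F m) ⟩
    + ((2 ℕ.+ m) ℕ.* ((2 ℕ.+ m) ℕ.* (Q ℕ.* q)))
      ≡⟨ cong +_ (ℕS.solve 3 (λ m Q q → (ℕS.con 2 ℕS.:+ m) ℕS.:* ((ℕS.con 2 ℕS.:+ m) ℕS.:* (Q ℕS.:* q)) ℕS.:=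
           Q ℕS.:* (q ℕS.:* ((ℕS.con 1 ℕS.:+ m ℕS.:+ ℕS.con 1) ℕS.:^ 2))) refl m Q q) ⟩
    + (Q ℕ.* (q ℕ.* (n ℕ.+ 1) ℕ.^ 2))  ≡⟨ ℤₚ.pos-* Q _ ⟩
    + Q * + (q ℕ.* (n ℕ.+ 1) ℕ.^ 2)    ≡⟨ cong (+ Q *_) (ℤₚ.pos-* q ((n ℕ.+ 1) ℕ.^ 2)) ⟩
    + Q * (+ q * + ((n ℕ.+ 1) ℕ.^ 2))  ≡⟨ cong (λ x → + Q * (+ q * x)) (pos-^ (n ℕ.+ 1) 2) ⟨
    + Q * (+ q * N²)                 ∎
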